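{- For every integer $m\geq 2$ with $m\neq 6$, let $k$ be the unique integer such that $2^k+2^{k-1}\leq m<2^k+2^{k+1}$. Then $$h_2(m)=\frac{2^kh_2(2^k)}{m}+\frac{(m-2^k)h_2(m-2^k)}{m}+\frac{2^k(m-2^k)}{m2^{m-1}}.$$
   Context: A triangular choice multigraph (TCM) $\mathcal{G}$ on a vertex set $V$ is obtained by choosing, for every 3-element subset $\{u,v,w\}\subseteq V$, exactly one of the pairs $uv,uw,vw$ and adding one copy of it as an edge; $m^{\mathcal{G}}_{xy}$ is the multiplicity of $xy$; for a TCM on $[m]$, $w(\mathcal{G},2)=\sum_{xy\in\binom{[m]}{2}}2^{m^{\mathcal{G}}_{xy}}$. A TCM $\mathcal{G}$ on $V$ is 2-recursive if either $|V|\in\{1,2\}$ and $\mathcal{G}$ is empty, or $|V|\geq 3$ and there is a partition $V=V_1\cup V_2$ with $V_1,V_2\neq\emptyset$ such that $\mathcal{G}=\mathcal{G}_1\cup\mathcal{G}_2\cup\mathcal{G}_3$ (union with multiplicities), where $\mathcal{G}_i$ is a 2-recursive TCM on $V_i$ and $\mathcal{G}_3$ consists of: for every triple with $u,v\in V_1$, $w\in V_2$ a copy of $uv$, and for every triple with $u\in V_1$, $v,w\in V_2$ a copy of $vw$. $H_2(m)$ is the maximum of $w(\mathcal{G},2)$ over all 2-recursive TCMs on $[m]$, and $h_2(m)=H_2(m)/(m2^{m-1})$ for $m\geq 1$. -}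

module Defs where

open import Data.Nat using (ℕ; zero; suc; _+_; _*_; _∸_; _^_; _≤_; _<ᵇ_)
open import Data.Bool using (Bool; true; false; if_then_else_; _∧_)
open import Data.Fin using (Fin; toℕ)
open import Data.Fin.Subset using (Subset; ∣_∣; _∪_; _∩_; ⊥; ⊤; Nonempty)
open import Data.Vec using (lookup)
open import Data.List using (List; map; allFin; concatMap)
open import Data.Nat.ListAction using (sum)
open import Data.Integer using (+_)
open import Data.Rational using (ℚ; _/_; 0ℚ)
open import Data.Sum using (_⊎_)
open import Data.Product using (Σ; _×_)
open import Relation.Binary.PropositionalEquality using (_≡_)

-- A multigraph on (a subset of) Fin m, given by its multiplicity function
-- on ordered pairs (only pairs x ≠ y are meaningful; all our multigraphs
-- are symmetric with zero diagonal).
Mult : ℕ → Set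
Mult m = Fin m → Fin m → ℕ

-- The multigraph G₃ of the 2-recursive definition for a partition V₁ ∪ V₂:
-- a pair uv with u ≠ v both in V₁ receives one copy for each w ∈ V₂
-- (the triples {u,v,w}), i.e. multiplicity ∣V₂∣; symmetrically a pair
-- with both ends in V₂ receives ∣V₁∣ copies; all other pairs get 0.
cross : ∀ {m} → Subset m → Subset m → Mult m
cross V₁ V₂ x y =
  if (toℕ x <ᵇ toℕ y) Data.Bool.∨ (toℕ y <ᵇ toℕ x)
  then (if lookup V₁ x ∧ lookup V₁ y then ∣ V₂ ∣
        else if lookup V₂ x ∧ lookup V₂ y then ∣ V₁ ∣ else 0)
  else 0

data Rec2 {m : ℕ} : Subset m → Mult m → Set where
  base : ∀ {V M} → (∣ V ∣ ≡ 1 ⊎ ∣ V ∣ ≡ 2) →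
         (∀ x y → M x y ≡ 0) → Rec2 V M
  split : ∀ {V M} (V₁ V₂ : Subset m) (M₁ M₂ : Mult m) →
          3 ≤ ∣ V ∣ →
          Nonempty V₁ → Nonempty V₂ →
          V₁ ∪ V₂ ≡ V → V₁ ∩ V₂ ≡ ⊥ →
          Rec2 V₁ M₁ → Rec2 V₂ M₂ →
          (∀ x y → M x y ≡ M₁ x y + M₂ x y + cross V₁ V₂ x y) →
          Rec2 V M

weight2 : ∀ {m} → Mult m → ℕ
weight2 {m} M = sum (concatMap (λ x → map (λ y →
  if toℕ x <ᵇ toℕ y then 2 ^ M x y else 0) (allFin m)) (allFin m))

IsH2 : ℕ → ℕ → Set
IsH2 m h = Σ (Mult m) (λ M → Rec2 ⊤ M × weight2 M ≡ h)
         × (∀ (M : Mult m) → Rec2 ⊤ M → weight2 M ≤ h)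

-- a / d as a rational (d ≠ 0 in all uses; value at d = 0 is a dummy)
divℕ : ℕ → ℕ → ℚ
divℕ a zero = 0ℚ
divℕ a (suc d) = (+ a) / suc d

hval : ℕ → ℕ → ℚ
hval m H = divℕ H (m * 2 ^ (m ∸ 1))

{-# OPTIONS --safe #-}
-- A 2-recursive TCM is encoded by the binary tree of its splits, and a split of sizes p and q turns the
-- weights a and b of its parts into 2^q a + 2^p b + p q.  Scaled by 2^-n, the optimal weight f becomes
-- additive up to a bonus: f p + f q + φ p φ q with φ n = n / 2^n.  Let H be given by the recursion of the
-- theorem; by induction on p + q it is superadditive in this sense.  A split (p , q) is turned by tree
-- rotations into one with a power of two as a part, and then into the prescribed one.  The gain of each
-- rotation is a sum of products of differences of φ, which does not increase from 1 on, and of a term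
-- (c - p)(q - c) / 2^m when the root split (p , q) becomes (c , m - c).  For sizes 3 + 3 the rotation
-- ((2 , 1) , (2 , 1)) ↝ ((2 , 2) , (1 , 1)) loses, hence the exception 6; splits with both parts at most
-- 11, where it interferes, are compared by computation.
module Submission where

open import Defs
open import Data.Bool using (Bool; true; false; if_then_else_; _∧_; _∨_; T)
open import Data.Empty using (⊥-elim)
import Data.Integer as ℤ
import Data.Integer.Properties as ℤ
open import Data.List using ([]; _∷_)
open import Data.Maybe using (Maybe; nothing; just)
open import Data.Nat using (ℕ; zero; suc; _+_; _*_; _∸_; _^_; _≤_; _<_; _<ᵇ_; _≡ᵇ_; z≤n; s≤s)
import Data.Nat as ℕ
open import Data.Nat.Induction using (<-rec)
import Data.Nat.Properties as ℕ
import Data.Nat.Tactic.RingSolver as ℕ-Solver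
open import Data.Product using (_×_; _,_; proj₁; proj₂; ∃-syntax)
open import Data.Rational using (ℚ; 0ℚ; 1ℚ; _-_; -_; toℚᵘ; nonNegative; _/_)
  renaming (_+_ to _+ℚ_; _*_ to _*ℚ_; _≤_ to _≤ℚ_)
open import Data.Rational.Properties
import Data.Rational.Unnormalised as ℚᵘ
import Data.Rational.Unnormalised.Properties as ℚᵘ
open import Data.Sum using (_⊎_; inj₁; inj₂)
open import Level using (0ℓ)
open import Relation.Binary using (tri<; tri≈; tri>)
open import Relation.Binary.PropositionalEquality
open import Relation.Nullary using (¬_; Dec; yes; no)
open import Relation.Nullary.Decidable using (from-yes; from-no)
open import Tactic.RingSolver using (solve-∀)
import Tactic.RingSolver.Core.AlmostCommutativeRing as ACR

-- The scaled weight n / 2^n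

-- The obstacle is the equality `φ 1 = φ 2 = 1/2`. A rotation that moves the root split outwards has
-- a loss at the root, to be paid by a product of two differences of `φ`. It is paid because
-- `φ a - φ b ≥ (b - a) / 2^b` for `2 ≤ a ≤ b`, an estimate that fails at `a = 1`, `b = 2`. For ((2
-- , 1) , (2 , 1)) the product is 0 and the loss is 1/64, that is, one unit of unscaled weight: 73
-- for 3 + 3 against 72 for 4 + 2. The bound 11 comes from here as well. 12 is the first size whose
-- prescribed power is 8. From then on half of that power is at least 4, so in every losing rotation
-- the differences of `φ` are taken at sizes at least 2, and the sizes that are opened along their
-- prescribed split stay above 6.

ring : ACR.AlmostCommutativeRing 0ℓ 0ℓ
ring = ACR.fromCommutativeRing +-*-commutativeRing is0
  where
  is0 : ∀ x → Maybe (0ℚ ≡ x)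
  is0 x with 0ℚ ≟ x
  ... | yes p = just p
  ... | no _ = nothing

infixl 6 _⊕_
infixl 7 _⊗_

_⊕_ : ∀ {x y} → 0ℚ ≤ℚ x → 0ℚ ≤ℚ y → 0ℚ ≤ℚ x +ℚ y
_⊕_ = +-mono-≤

_⊗_ : ∀ {x y} → 0ℚ ≤ℚ x → 0ℚ ≤ℚ y → 0ℚ ≤ℚ x *ℚ y
_⊗_ {x} {y} p q = subst (_≤ℚ x *ℚ y) (*-zeroʳ x) (*-monoˡ-≤-nonNeg x ⦃ nonNegative p ⦄ q)

slack : ∀ {x y} → x ≤ℚ y → 0ℚ ≤ℚ y - x
slack {x} {y} p = subst (_≤ℚ y - x) (+-inverseʳ x) (+-monoˡ-≤ (- x) p)

unslack : ∀ {x y} → 0ℚ ≤ℚ y - x → x ≤ℚ y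
unslack {x} {y} p = subst₂ _≤ℚ_ (+-identityˡ x) (cancel y x) (+-monoˡ-≤ x p)
  where
  cancel : ∀ y x → y - x +ℚ x ≡ y
  cancel = solve-∀ ring

by-slack : ∀ {x y z} → y - x ≡ z → 0ℚ ≤ℚ z → x ≤ℚ y
by-slack e p = unslack (subst (0ℚ ≤ℚ_) (sym e) p)

-- Recursive rather than a quotient by 1, so that additivity and multiplicativity are inductions
-- closed by ring laws, without normalising fractions.
ι : ℕ → ℚ
ι zero    = 0ℚ
ι (suc n) = 1ℚ +ℚ ι n

ι-+ : ∀ a b → ι (a + b) ≡ ι a +ℚ ι b
ι-+ zero    b = sym (+-identityˡ (ι b))
ι-+ (suc a) b = trans (cong (1ℚ +ℚ_) (ι-+ a b)) (sym (+-assoc 1ℚ (ι a) (ι b)))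

ι-* : ∀ a b → ι (a * b) ≡ ι a *ℚ ι b
ι-* zero    b = sym (*-zeroˡ (ι b))
ι-* (suc a) b = begin
  ι (b + a * b)       ≡⟨ ι-+ b (a * b) ⟩
  ι b +ℚ ι (a * b)    ≡⟨ cong (ι b +ℚ_) (ι-* a b) ⟩
  ι b +ℚ ι a *ℚ ι b   ≡⟨ lemma (ι a) (ι b) ⟩
  (1ℚ +ℚ ι a) *ℚ ι b  ∎
  where
  open ≡-Reasoning
  lemma : ∀ x y → y +ℚ x *ℚ y ≡ (1ℚ +ℚ x) *ℚ y
  lemma = solve-∀ ring

ι-nonneg : ∀ n → 0ℚ ≤ℚ ι n
ι-nonneg zero    = ≤-refl
ι-nonneg (suc n) = nonNegative⁻¹ 1ℚ ⊕ ι-nonneg n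

ι-mono : ∀ {a b} → a ≤ b → ι a ≤ℚ ι b
ι-mono {b = b} z≤n = ι-nonneg b
ι-mono (s≤s p) = +-monoʳ-≤ 1ℚ (ι-mono p)

toℚᵘ-ι : ∀ n → toℚᵘ (ι n) ℚᵘ.≃ ℚᵘ.mkℚᵘ (ℤ.+ n) 0
toℚᵘ-ι zero    = ℚᵘ.≃-refl
toℚᵘ-ι (suc n) = ℚᵘ.≃-trans (toℚᵘ-homo-+ 1ℚ (ι n))
  (ℚᵘ.≃-trans (ℚᵘ.+-congʳ (toℚᵘ 1ℚ) (toℚᵘ-ι n))
      (ℚᵘ.*≡* (cong (λ x → (ℤ.1ℤ ℤ.+ x) ℤ.* ℤ.1ℤ) (ℤ.*-identityʳ (ℤ.+ n)))))

inv : ℕ → ℚ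
inv = divℕ 1

-- Separates numerator and denominator, so that everything later is ring arithmetic in `ι` and
-- `inv`. The dummy value 0 at denominator 0 keeps the identity unconditional.
divℕ≡ι*inv : ∀ a d → divℕ a d ≡ ι a *ℚ inv d
divℕ≡ι*inv a zero    = sym (*-zeroʳ (ι a))
divℕ≡ι*inv a (suc d) = toℚᵘ-injective (begin
  toℚᵘ (ℤ.+ a / suc d)
    ≈⟨ toℚᵘ-fromℚᵘ (ℚᵘ.mkℚᵘ (ℤ.+ a) d) ⟩
  ℚᵘ.mkℚᵘ (ℤ.+ a) d
    ≈⟨ ℚᵘ.*≡* (cong₂ ℤ._*_ (sym (ℤ.*-identityʳ (ℤ.+ a))) (cong ℤ.+_ (ℕ.*-identityˡ (suc d)))) ⟩
  ℚᵘ.mkℚᵘ (ℤ.+ a) 0 ℚᵘ.* ℚᵘ.mkℚᵘ (ℤ.+ 1) d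
    ≈⟨ ℚᵘ.*-cong (toℚᵘ-ι a) (toℚᵘ-fromℚᵘ (ℚᵘ.mkℚᵘ (ℤ.+ 1) d)) ⟨
  toℚᵘ (ι a) ℚᵘ.* toℚᵘ (ℤ.+ 1 / suc d)
    ≈⟨ toℚᵘ-homo-* (ι a) (ℤ.+ 1 / suc d) ⟨
  toℚᵘ (ι a *ℚ inv (suc d)) ∎)
  where open ℚᵘ.≃-Reasoning

ι*inv : ∀ d → .⦃ ℕ.NonZero d ⦄ → ι d *ℚ inv d ≡ 1ℚ
ι*inv (suc d) = trans (sym (divℕ≡ι*inv (suc d) (suc d))) (toℚᵘ-injective (begin
  toℚᵘ (ℤ.+ suc d / suc d)  ≈⟨ toℚᵘ-fromℚᵘ (ℚᵘ.mkℚᵘ (ℤ.+ suc d) d) ⟩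
  ℚᵘ.mkℚᵘ (ℤ.+ suc d) d     ≈⟨ ℚᵘ.*≡* (ℤ.*-comm (ℤ.+ suc d) (ℤ.+ 1)) ⟩
  toℚᵘ 1ℚ                   ∎))
  where open ℚᵘ.≃-Reasoning

inv-* : ∀ a b → .⦃ ℕ.NonZero a ⦄ → .⦃ ℕ.NonZero b ⦄ → inv (a * b) ≡ inv a *ℚ inv b
inv-* a b = begin
  inv (a * b)
    ≡⟨ *-identityʳ _ ⟨
  inv (a * b) *ℚ 1ℚ
    ≡⟨ cong₂ (λ x y → inv (a * b) *ℚ (x *ℚ y)) (ι*inv a) (ι*inv b) ⟨
  inv (a * b) *ℚ ((ι a *ℚ inv a) *ℚ (ι b *ℚ inv b))
    ≡⟨ shuffle (inv (a * b)) (ι a) (inv a) (ι b) (inv b) ⟩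
  (ι a *ℚ ι b *ℚ inv (a * b)) *ℚ (inv a *ℚ inv b)
    ≡⟨ cong (λ x → x *ℚ inv (a * b) *ℚ (inv a *ℚ inv b)) (ι-* a b) ⟨
  (ι (a * b) *ℚ inv (a * b)) *ℚ (inv a *ℚ inv b)
    ≡⟨ cong (_*ℚ (inv a *ℚ inv b)) (ι*inv (a * b) ⦃ ℕ.m*n≢0 a b ⦄) ⟩
  1ℚ *ℚ (inv a *ℚ inv b)
    ≡⟨ *-identityˡ _ ⟩
  inv a *ℚ inv b ∎
  where
  open ≡-Reasoning
  shuffle : ∀ w x x′ y y′ → w *ℚ ((x *ℚ x′) *ℚ (y *ℚ y′)) ≡ (x *ℚ y *ℚ w) *ℚ (x′ *ℚ y′)
  shuffle = solve-∀ ring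

inv-nonneg : ∀ d → 0ℚ ≤ℚ inv d
inv-nonneg zero    = ≤-refl
inv-nonneg (suc d) = nonNegative⁻¹ (inv (suc d)) ⦃ normalize-nonNeg 1 (suc d) ⦄

ε φ : ℕ → ℚ
ε n = inv (2 ^ n)
φ n = ι n *ℚ ε n

ε-+ : ∀ a b → ε (a + b) ≡ ε a *ℚ ε b
ε-+ a b = trans (cong inv (ℕ.^-distribˡ-+-* 2 a b)) (inv-* (2 ^ a) (2 ^ b) ⦃ ℕ.m^n≢0 2 a ⦄ ⦃ ℕ.m^n≢0 2 b ⦄)

ε-nonneg : ∀ n → 0ℚ ≤ℚ ε n
ε-nonneg n = inv-nonneg (2 ^ n)

ι*ε : ∀ n → ι (2 ^ n) *ℚ ε n ≡ 1ℚ
ι*ε n = ι*inv (2 ^ n) ⦃ ℕ.m^n≢0 2 n ⦄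

φ-nonneg : ∀ n → 0ℚ ≤ℚ φ n
φ-nonneg n = ι-nonneg n ⊗ ε-nonneg n

ε-rescale : ∀ a d → ε a ≡ ι (2 ^ d) *ℚ ε (a + d)
ε-rescale a d = begin
  ε a                        ≡⟨ *-identityʳ _ ⟨
  ε a *ℚ 1ℚ                  ≡⟨ cong (ε a *ℚ_) (ι*ε d) ⟨
  ε a *ℚ (ι (2 ^ d) *ℚ ε d)  ≡⟨ swap (ε a) (ι (2 ^ d)) (ε d) ⟩
  ι (2 ^ d) *ℚ (ε a *ℚ ε d)  ≡⟨ cong (ι (2 ^ d) *ℚ_) (ε-+ a d) ⟨
  ι (2 ^ d) *ℚ ε (a + d)     ∎
  where
  open ≡-Reasoning
  swap : ∀ x y z → x *ℚ (y *ℚ z) ≡ y *ℚ (x *ℚ z)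
  swap = solve-∀ ring

*ε-mono : ∀ {x y} n → x ≤ℚ y → x *ℚ ε n ≤ℚ y *ℚ ε n
*ε-mono n = *-monoʳ-≤-nonNeg (ε n) ⦃ nonNegative (ε-nonneg n) ⦄

1+d≤2^d : ∀ d → suc d ≤ 2 ^ d
1+d≤2^d zero    = ℕ.≤-refl
1+d≤2^d (suc d) = ℕ.+-mono-≤ (ℕ.>-nonZero⁻¹ (2 ^ d) ⦃ ℕ.m^n≢0 2 d ⦄)
                             (ℕ.≤-trans (1+d≤2^d d) (ℕ.m≤m+n (2 ^ d) 0))

ε-antitone : ∀ {a b} → a ≤ b → ε b ≤ℚ ε a
ε-antitone {a} a≤b with d , refl ← ℕ.m≤n⇒∃[o]m+o≡n a≤b = begin
  ε (a + d)               ≡⟨ *-identityˡ _ ⟨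
  1ℚ *ℚ ε (a + d)         ≤⟨ *ε-mono (a + d) (ι-mono {1} (ℕ.≤-trans (s≤s z≤n) (1+d≤2^d d))) ⟩
  ι (2 ^ d) *ℚ ε (a + d)  ≡⟨ ε-rescale a d ⟨
  ε a                     ∎
  where open ≤-Reasoning

φ-rescale : ∀ a d → φ a ≡ ι (a * 2 ^ d) *ℚ ε (a + d)
φ-rescale a d = begin
  ι a *ℚ ε a                       ≡⟨ cong (ι a *ℚ_) (ε-rescale a d) ⟩
  ι a *ℚ (ι (2 ^ d) *ℚ ε (a + d))  ≡⟨ *-assoc (ι a) _ _ ⟨
  ι a *ℚ ι (2 ^ d) *ℚ ε (a + d)    ≡⟨ cong (_*ℚ ε (a + d)) (ι-* a (2 ^ d)) ⟨
  ι (a * 2 ^ d) *ℚ ε (a + d)       ∎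
  where open ≡-Reasoning

-- Over the common denominator `2 ^ (a + d)` this is `a + d ≤ a * 2 ^ d`, which follows from
-- `1 + d ≤ 2 ^ d` once `a` is positive.
φ-antitone : ∀ {a b} → 1 ≤ a → a ≤ b → φ b ≤ℚ φ a
φ-antitone {suc a} _ a≤b with d , refl ← ℕ.m≤n⇒∃[o]m+o≡n a≤b =
  subst (φ (suc a + d) ≤ℚ_) (sym (φ-rescale (suc a) d)) (*ε-mono (suc a + d) (ι-mono bound))
  where
  bound : suc a + d ≤ suc a * 2 ^ d
  bound = begin
    suc a + d      ≡⟨ ℕ-Solver.solve (a ∷ d ∷ []) ⟩
    suc d + a * 1  ≤⟨ ℕ.+-mono-≤ (1+d≤2^d d) (ℕ.*-monoʳ-≤ a (ℕ.≤-trans (s≤s z≤n) (1+d≤2^d d))) ⟩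
    suc a * 2 ^ d  ∎
    where open ℕ.≤-Reasoning

φ-gap-shape : ∀ a d → ι (a * 2 ^ d) *ℚ ε (a + d) - ι (a + d + d) *ℚ ε (a + d)
              ≡ φ a - φ (a + d) - (ι (a + d) - ι a) *ℚ ε (a + d)
φ-gap-shape a d = begin
  ι (a * 2 ^ d) *ℚ e - ι (a + d + d) *ℚ e
    ≡⟨ cong₂ (λ x y → x - y *ℚ e) (sym (φ-rescale a d)) (trans (ι-+ (a + d) d) (cong (_+ℚ ι d) (ι-+ a d))) ⟩
  φ a - (ι a +ℚ ι d +ℚ ι d) *ℚ e
    ≡⟨ shape (φ a) (ι a) (ι d) e ⟩
  φ a - (ι a +ℚ ι d) *ℚ e - (ι a +ℚ ι d - ι a) *ℚ e
    ≡⟨ cong (λ x → φ a - x *ℚ e - (x - ι a) *ℚ e) (ι-+ a d) ⟨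
  φ a - φ (a + d) - (ι (a + d) - ι a) *ℚ e ∎
  where
  open ≡-Reasoning
  e : ℚ
  e = ε (a + d)
  shape : ∀ x y z e → x - (y +ℚ z +ℚ z) *ℚ e ≡ x - (y +ℚ z) *ℚ e - (y +ℚ z - y) *ℚ e
  shape = solve-∀ ring

-- Over the common denominator this is `a + 2 d ≤ a * 2 ^ d`: two of the `a` copies of `2 ^ d`
-- absorb a `d` each. The shape of the lower bound is that of one factor of the loss in `exchange`,
-- so two gaps multiplied pay for one loss.
φ-gap : ∀ {a b} → 2 ≤ a → a ≤ b → (ι b - ι a) *ℚ ε b ≤ℚ φ a - φ b
φ-gap {suc (suc a)} (s≤s (s≤s _)) a≤b with d , refl ← ℕ.m≤n⇒∃[o]m+o≡n a≤b =
  unslack (subst (0ℚ ≤ℚ_) (φ-gap-shape (suc (suc a)) d) (slack (*ε-mono (suc (suc a) + d) (ι-mono bound))))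
  where
  bound : suc (suc a) + d + d ≤ suc (suc a) * 2 ^ d
  bound = begin
    suc (suc a) + d + d
      ≡⟨ ℕ-Solver.solve (a ∷ d ∷ []) ⟩
    suc d + (suc d + a * 1)
      ≤⟨ ℕ.+-mono-≤ (1+d≤2^d d) (ℕ.+-mono-≤ (1+d≤2^d d) (ℕ.*-monoʳ-≤ a (ℕ.≤-trans (s≤s z≤n) (1+d≤2^d d)))) ⟩
    suc (suc a) * 2 ^ d ∎
    where open ℕ.≤-Reasoning

-- Equal sums give both products the same denominator, and `p q - c d = (c - p)(c - q)`. The
-- difference is a loss exactly when `c` lies strictly outside the interval between `p` and `q`.
exchange : ∀ p q c d → c + d ≡ p + q →
           φ p *ℚ φ q - φ c *ℚ φ d ≡ (ι c - ι p) *ℚ (ι c - ι q) *ℚ ε (p + q)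
exchange p q c d e = begin
  ι p *ℚ ε p *ℚ (ι q *ℚ ε q) - ι c *ℚ ε c *ℚ (ι d *ℚ ε d)
    ≡⟨ group (ι p) (ι q) (ι c) (ι d) (ε p) (ε q) (ε c) (ε d) ⟩
  ι p *ℚ ι q *ℚ (ε p *ℚ ε q) - ι c *ℚ ι d *ℚ (ε c *ℚ ε d)
    ≡⟨ cong₂ (λ x y → ι p *ℚ ι q *ℚ x - ι c *ℚ ι d *ℚ y) (sym (ε-+ p q)) (trans (sym (ε-+ c d)) (cong ε e)) ⟩
  ι p *ℚ ι q *ℚ ε (p + q) - ι c *ℚ ι d *ℚ ε (p + q)
    ≡⟨ cong (λ x → ι p *ℚ ι q *ℚ ε (p + q) - ι c *ℚ x *ℚ ε (p + q)) d≡ ⟩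
  ι p *ℚ ι q *ℚ ε (p + q) - ι c *ℚ (ι p +ℚ ι q - ι c) *ℚ ε (p + q)
    ≡⟨ factor (ι p) (ι q) (ι c) (ε (p + q)) ⟩
  (ι c - ι p) *ℚ (ι c - ι q) *ℚ ε (p + q) ∎
  where
  open ≡-Reasoning
  group : ∀ p q c d w x y z → p *ℚ w *ℚ (q *ℚ x) - c *ℚ y *ℚ (d *ℚ z) ≡ p *ℚ q *ℚ (w *ℚ x) - c *ℚ d *ℚ (y *ℚ z)
  group = solve-∀ ring
  factor : ∀ p q c e → p *ℚ q *ℚ e - c *ℚ (p +ℚ q - c) *ℚ e ≡ (c - p) *ℚ (c - q) *ℚ e
  factor = solve-∀ ring
  isolate : ∀ c d → d ≡ c +ℚ d - c
  isolate = solve-∀ ring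
  d≡ : ι d ≡ ι p +ℚ ι q - ι c
  d≡ = trans (isolate (ι c) (ι d)) (cong (_- ι c) (trans (sym (ι-+ c d)) (trans (cong ι e) (ι-+ p q))))

exchange-inside : ∀ {p q c d} → p ≤ c → c ≤ q → c + d ≡ p + q → φ p *ℚ φ q ≤ℚ φ c *ℚ φ d
exchange-inside {p} {q} {c} {d} p≤c c≤q e = by-slack
  (trans (flip (φ c *ℚ φ d) (φ p *ℚ φ q))
      (trans (cong -_ (exchange p q c d e)) (signs (ι p) (ι q) (ι c) (ε (p + q)))))
  (slack (ι-mono p≤c) ⊗ slack (ι-mono c≤q) ⊗ ε-nonneg (p + q))
  where
  flip : ∀ x y → x - y ≡ - (y - x)
  flip = solve-∀ ring
  signs : ∀ p q c e → - ((c - p) *ℚ (c - q) *ℚ e) ≡ (c - p) *ℚ (q - c) *ℚ e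
  signs = solve-∀ ring

*-mono-≤-nonneg : ∀ {x y X Y} → 0ℚ ≤ℚ x → 0ℚ ≤ℚ y → x ≤ℚ X → y ≤ℚ Y → x *ℚ y ≤ℚ X *ℚ Y
*-mono-≤-nonneg {x} {y} {X} {Y} 0≤x 0≤y x≤X y≤Y = by-slack (shape x y X Y)
  (slack x≤X ⊗ (0≤y ⊕ slack y≤Y) ⊕ 0≤x ⊗ slack y≤Y)
  where
  shape : ∀ x y X Y → X *ℚ Y - x *ℚ y ≡ (X - x) *ℚ (y +ℚ (Y - y)) +ℚ x *ℚ (Y - y)
  shape = solve-∀ ring

-- Rotations of split trees

-- In a comment T ↝ T′, a pair (p , q) is a split into parts of sizes p and q; the lemma says that
-- replacing T by T′ does not decrease the value.
module Rotations (f : ℕ → ℚ) where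

  -- In the lemmas below, a hypothesis `f n ≤ join ..` opens a part along an optimal split, and a
  -- hypothesis `join .. ≤ f n` closes two pieces into one part. What remains is a comparison of the
  -- bonuses `φ p * φ q` alone.
  join : ℕ → ℕ → ℚ
  join p q = f p +ℚ f q +ℚ φ p *ℚ φ q

  join-comm : ∀ p q → join p q ≡ join q p
  join-comm p q = shape (f p) (f q) (φ p) (φ q)
    where
    shape : ∀ a b x y → a +ℚ b +ℚ x *ℚ y ≡ b +ℚ a +ℚ y *ℚ x
    shape = solve-∀ ring

  -- (p , (b , t))  ↝  (b , (p , t))
  rotate : ∀ {p b t} → 1 ≤ p → p ≤ b →
           f (b + t) ≤ℚ join b t → join p t ≤ℚ f (p + t) →
           join p (b + t) ≤ℚ join b (p + t)
  rotate {p} {b} {t} 1≤p p≤b hq h = by-slack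
    (shape (f p) (f (b + t)) (f b) (f (p + t)) (f t) (φ p) (φ b) (φ t) (φ p *ℚ φ (b + t)) (φ b *ℚ φ (p + t)))
    -- The piece `t` exchanges its partner `b` for the smaller `p`, and the root split moves
    -- inwards, as `b` lies between `p` and `b + t`.
    (slack hq ⊕ slack h ⊕ φ-nonneg t ⊗ slack (φ-antitone 1≤p p≤b)
      ⊕ slack (exchange-inside p≤b (ℕ.m≤m+n b t) (total p b t)))
    where
    total : ∀ p b t → b + (p + t) ≡ p + (b + t)
    total = ℕ-Solver.solve-∀
    shape : ∀ p q b r t P B T X Y → b +ℚ r +ℚ Y - (p +ℚ q +ℚ X) ≡
            (b +ℚ t +ℚ B *ℚ T - q) +ℚ (r - (p +ℚ t +ℚ P *ℚ T)) +ℚ T *ℚ (P - B) +ℚ (Y - X)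
    shape = solve-∀ ring

  -- ((c , r) , (c , s))  ↝  ((c , c) , (r , s))
  private
    pair-equal′ : ∀ {c r s} →
      (ι c - ι r) *ℚ (ι c - ι s) *ℚ ε (c + r + (c + s)) ≤ℚ (φ c - φ r) *ℚ (φ c - φ s) →
      f (c + r) ≤ℚ join c r → f (c + s) ≤ℚ join c s →
      join c c ≤ℚ f (c + c) → join r s ≤ℚ f (r + s) →
      join (c + r) (c + s) ≤ℚ join (c + c) (r + s)
    pair-equal′ {c} {r} {s} gain hp hq hcc hrs = by-slack
      (shape (f (c + r)) (f (c + s)) (f (c + c)) (f (r + s)) (f c) (f r) (f s) (φ c) (φ r) (φ s)
        (φ (c + r) *ℚ φ (c + s)) (φ (c + c) *ℚ φ (r + s)))
      -- The new pairing changes the inner bonuses by `C C + R S - C R - C S = (C - R)(C - S)`; the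
      -- last summand sets this against the change at the root.
      (slack hp ⊕ slack hq ⊕ slack hcc ⊕ slack hrs ⊕ slack
          (subst (_≤ℚ (φ c - φ r) *ℚ (φ c - φ s)) (sym exch) gain))
      where
      shape : ∀ p q cc rs c r s C R S X Y → cc +ℚ rs +ℚ Y - (p +ℚ q +ℚ X) ≡
              (c +ℚ r +ℚ C *ℚ R - p) +ℚ (c +ℚ s +ℚ C *ℚ S - q) +ℚ (cc - (c +ℚ c +ℚ C *ℚ C)) +ℚ
                  (rs - (r +ℚ s +ℚ R *ℚ S))
              +ℚ ((C - R) *ℚ (C - S) - (X - Y))
      shape = solve-∀ ring
      simp : ∀ c r s e → (c +ℚ c - (c +ℚ r)) *ℚ (c +ℚ c - (c +ℚ s)) *ℚ e ≡ (c - r) *ℚ (c - s) *ℚ e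
      simp = solve-∀ ring
      exch : φ (c + r) *ℚ φ (c + s) - φ (c + c) *ℚ φ (r + s) ≡ (ι c - ι r) *ℚ (ι c - ι s) *ℚ ε (c + r + (c + s))
      exch = trans (exchange (c + r) (c + s) (c + c) (r + s) (ℕ-Solver.solve (c ∷ r ∷ s ∷ [])))
             (trans (cong₂ (λ x y → x *ℚ y *ℚ ε (c + r + (c + s)))
                      (cong₂ _-_ (ι-+ c c) (ι-+ c r)) (cong₂ _-_ (ι-+ c c) (ι-+ c s)))
                    (simp (ι c) (ι r) (ι s) (ε (c + r + (c + s)))))

  -- Here `c + c` is at least as large as both old parts, so the root loses. The denominator of the
  -- loss is at least that of `ε c * ε c`, and the loss then factors into the lower bounds of
  -- `φ-gap` for `r` and for `s`.
  pair-equal-below : ∀ {c r s} → 2 ≤ r → 2 ≤ s → r ≤ c → s ≤ c →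
    f (c + r) ≤ℚ join c r → f (c + s) ≤ℚ join c s →
    join c c ≤ℚ f (c + c) → join r s ≤ℚ f (r + s) →
    join (c + r) (c + s) ≤ℚ join (c + c) (r + s)
  pair-equal-below {c} {r} {s} 2≤r 2≤s r≤c s≤c = pair-equal′ (begin
    (ι c - ι r) *ℚ (ι c - ι s) *ℚ ε (c + r + (c + s))
      ≤⟨ *-monoˡ-≤-nonNeg ((ι c - ι r) *ℚ (ι c - ι s)) ⦃ nonNegative (slack (ι-mono r≤c) ⊗ slack (ι-mono s≤c)) ⦄
          (ε-antitone {c + c} (ℕ.+-mono-≤ (ℕ.m≤m+n c r) (ℕ.m≤m+n c s))) ⟩
    (ι c - ι r) *ℚ (ι c - ι s) *ℚ ε (c + c)
      ≡⟨ cong ((ι c - ι r) *ℚ (ι c - ι s) *ℚ_) (ε-+ c c) ⟩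
    (ι c - ι r) *ℚ (ι c - ι s) *ℚ (ε c *ℚ ε c)
      ≡⟨ group (ι c - ι r) (ι c - ι s) (ε c) ⟩
    ((ι c - ι r) *ℚ ε c) *ℚ ((ι c - ι s) *ℚ ε c)
      ≤⟨ *-mono-≤-nonneg (slack (ι-mono r≤c) ⊗ ε-nonneg c) (slack (ι-mono s≤c) ⊗ ε-nonneg c) (φ-gap 2≤r r≤c)
          (φ-gap 2≤s s≤c) ⟩
    (φ r - φ c) *ℚ (φ s - φ c)
      ≡⟨ flip (φ r) (φ s) (φ c) ⟩
    (φ c - φ r) *ℚ (φ c - φ s) ∎)
    where
    open ≤-Reasoning
    group : ∀ x y e → x *ℚ y *ℚ (e *ℚ e) ≡ (x *ℚ e) *ℚ (y *ℚ e)
    group = solve-∀ ring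
    flip : ∀ r s c → (r - c) *ℚ (s - c) ≡ (c - r) *ℚ (c - s)
    flip = solve-∀ ring

  -- The mirror image: `c + c` is at most as large as both old parts, and the denominator is now
  -- compared with that of `ε r * ε s`.
  pair-equal-above : ∀ {c r s} → 2 ≤ c → c ≤ r → c ≤ s →
    f (c + r) ≤ℚ join c r → f (c + s) ≤ℚ join c s →
    join c c ≤ℚ f (c + c) → join r s ≤ℚ f (r + s) →
    join (c + r) (c + s) ≤ℚ join (c + c) (r + s)
  pair-equal-above {c} {r} {s} 2≤c c≤r c≤s = pair-equal′ (begin
    (ι c - ι r) *ℚ (ι c - ι s) *ℚ ε (c + r + (c + s))
      ≡⟨ cong (_*ℚ ε (c + r + (c + s))) (flip (ι c) (ι r) (ι s)) ⟩
    (ι r - ι c) *ℚ (ι s - ι c) *ℚ ε (c + r + (c + s))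
      ≤⟨ *-monoˡ-≤-nonNeg ((ι r - ι c) *ℚ (ι s - ι c)) ⦃ nonNegative (slack (ι-mono c≤r) ⊗ slack (ι-mono c≤s)) ⦄
          (ε-antitone {r + s} (ℕ.+-mono-≤ (ℕ.m≤n+m r c) (ℕ.m≤n+m s c))) ⟩
    (ι r - ι c) *ℚ (ι s - ι c) *ℚ ε (r + s)
      ≡⟨ cong ((ι r - ι c) *ℚ (ι s - ι c) *ℚ_) (ε-+ r s) ⟩
    (ι r - ι c) *ℚ (ι s - ι c) *ℚ (ε r *ℚ ε s)
      ≡⟨ group (ι r - ι c) (ι s - ι c) (ε r) (ε s) ⟩
    ((ι r - ι c) *ℚ ε r) *ℚ ((ι s - ι c) *ℚ ε s)
      ≤⟨ *-mono-≤-nonneg (slack (ι-mono c≤r) ⊗ ε-nonneg r) (slack (ι-mono c≤s) ⊗ ε-nonneg s) (φ-gap 2≤c c≤r)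
          (φ-gap 2≤c c≤s) ⟩
    (φ c - φ r) *ℚ (φ c - φ s) ∎)
    where
    open ≤-Reasoning
    group : ∀ x y e e′ → x *ℚ y *ℚ (e *ℚ e′) ≡ (x *ℚ e) *ℚ (y *ℚ e′)
    group = solve-∀ ring
    flip : ∀ c r s → (c - r) *ℚ (c - s) ≡ (r - c) *ℚ (s - c)
    flip = solve-∀ ring

  -- ((c , r) , (c , (c , t)))  ↝  ((c , c) , (c , (r , t)))
  pair-third : ∀ {c r t} → 1 ≤ r → 1 ≤ t → r ≤ c → t ≤ c →
    f (c + r) ≤ℚ join c r → f (c + (c + t)) ≤ℚ join c (c + t) → f (c + t) ≤ℚ join c t →
    join c c ≤ℚ f (c + c) → join c (r + t) ≤ℚ f (c + (r + t)) → join r t ≤ℚ f (r + t) →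
    join (c + r) (c + (c + t)) ≤ℚ join (c + c) (c + (r + t))
  pair-third {c} {r} {t} 1≤r 1≤t r≤c t≤c hp hq hs hcc hn hrt = by-slack
    (shape (f (c + r)) (f (c + (c + t))) (f (c + t)) (f (c + c)) (f (c + (r + t))) (f (r + t))
      (f c) (f r) (f t) (φ c) (φ r) (φ t) (φ (c + t)) (φ (r + t))
      (φ (c + r) *ℚ φ (c + (c + t))) (φ (c + c) *ℚ φ (c + (r + t))))
    (slack hp ⊕ slack hq ⊕ slack hs ⊕ slack hcc ⊕ slack hn ⊕ slack hrt
      ⊕ slack (φ-antitone 1≤r r≤c) ⊗ slack (φ-antitone 1≤t t≤c)
      ⊕ φ-nonneg c ⊗ slack (φ-antitone (ℕ.≤-trans 1≤r (ℕ.m≤m+n r t)) (ℕ.+-monoˡ-≤ t r≤c))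
      ⊕ slack (exchange-inside (ℕ.+-monoʳ-≤ c r≤c) (ℕ.+-monoʳ-≤ c (ℕ.m≤m+n c t)) (total c r t)))
    where
    total : ∀ c r t → c + c + (c + (r + t)) ≡ c + r + (c + (c + t))
    total = ℕ-Solver.solve-∀
    shape : ∀ p q s cc n rt c r t C R T S N X Y → cc +ℚ n +ℚ Y - (p +ℚ q +ℚ X) ≡
      (c +ℚ r +ℚ C *ℚ R - p) +ℚ (c +ℚ s +ℚ C *ℚ S - q) +ℚ (c +ℚ t +ℚ C *ℚ T - s)
      +ℚ (cc - (c +ℚ c +ℚ C *ℚ C)) +ℚ (n - (c +ℚ rt +ℚ C *ℚ N)) +ℚ (rt - (r +ℚ t +ℚ R *ℚ T))
      +ℚ (R - C) *ℚ (T - C) +ℚ C *ℚ (N - S) +ℚ (Y - X)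
    shape = solve-∀ ring

  -- Parts or pieces opened at `d` leave loose blocks `d`. Two of these make a block `c = d + d`,
  -- and two blocks `c` make the next power; `hdd` and `hcc` account for these merges.
  module Doubled {d : ℕ} (1≤d : 1 ≤ d)
    (hdd : join d d ≤ℚ f (d + d))
    (hcc : join (d + d) (d + d) ≤ℚ f (d + d + (d + d))) where

    private
      c : ℕ
      c = d + d
      d≤c : d ≤ c
      d≤c = ℕ.m≤m+n d d

    -- ((c , r) , (c , (d , t)))  ↝  ((c , c) , (c , x))   when (r , t) ↝ (d , x)
    pair-unequal-small : ∀ {r t x} → d ≤ r → r ≤ c → d ≤ t → r + t ≡ d + x →
      f (c + r) ≤ℚ join c r → f (c + (d + t)) ≤ℚ join c (d + t) → f (d + t) ≤ℚ join d t →
      join r t ≤ℚ f (r + t) → f (d + x) ≤ℚ join d x → join c x ≤ℚ f (c + x) →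
      join (c + r) (c + (d + t)) ≤ℚ join (c + c) (c + x)
    pair-unequal-small {r} {t} {x} d≤r r≤c d≤t e hp hq hs hrt hx hn = by-slack
      (shape (f (c + r)) (f (c + (d + t))) (f (d + t)) (f (c + c)) (f (c + x)) (f (d + x))
        (f c) (f d) (f r) (f t) (f x) (φ c) (φ d) (φ r) (φ t) (φ x) (φ (d + t))
        (φ (c + r) *ℚ φ (c + (d + t))) (φ (c + c) *ℚ φ (c + x)))
      -- The `d` cut off from `r + t` merges with the `d` next to `t` into the third block `c`, and
      -- `x` is left over.
      (slack hp ⊕ slack hq ⊕ slack hs ⊕ slack hcc ⊕ slack hdd ⊕ slack hn ⊕ slack hx
        ⊕ slack (subst (λ y → join r t ≤ℚ f y) e hrt)
        ⊕ slack (φ-antitone 1≤d d≤r) ⊗ slack (φ-antitone 1≤d d≤t)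
        ⊕ slack (φ-antitone 1≤d d≤c) ⊗ slack (φ-antitone (ℕ.≤-trans 1≤d d≤r) r≤x)
        ⊕ φ-nonneg c ⊗ slack (φ-antitone (ℕ.≤-trans 1≤d d≤c) (ℕ.+-monoʳ-≤ d d≤t))
        ⊕ slack (exchange-inside (ℕ.+-monoʳ-≤ c r≤c) (ℕ.+-monoʳ-≤ c (ℕ.+-monoʳ-≤ d d≤t)) total))
      where
      r≤x : r ≤ x
      r≤x = ℕ.+-cancelˡ-≤ d r x (subst (d + r ≤_) e (subst (_≤ r + t) (ℕ.+-comm r d) (ℕ.+-monoʳ-≤ r d≤t)))
      total : c + c + (c + x) ≡ c + r + (c + (d + t))
      total = trans (lhs d x) (trans (cong (λ y → d + d + (d + d) + d + y) (sym e)) (rhs d r t))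
        where
        lhs : ∀ d x → d + d + (d + d) + (d + d + x) ≡ d + d + (d + d) + d + (d + x)
        lhs = ℕ-Solver.solve-∀
        rhs : ∀ d r t → d + d + (d + d) + d + (r + t) ≡ d + d + r + (d + d + (d + t))
        rhs = ℕ-Solver.solve-∀
      shape : ∀ p q s cc n rt c d r t x C D R T X S U V → cc +ℚ n +ℚ V - (p +ℚ q +ℚ U) ≡
        (c +ℚ r +ℚ C *ℚ R - p) +ℚ (c +ℚ s +ℚ C *ℚ S - q) +ℚ (d +ℚ t +ℚ D *ℚ T - s)
        +ℚ (cc - (c +ℚ c +ℚ C *ℚ C)) +ℚ (c - (d +ℚ d +ℚ D *ℚ D)) +ℚ (n - (c +ℚ x +ℚ C *ℚ X)) +ℚ
            (d +ℚ x +ℚ D *ℚ X - rt) +ℚ (rt - (r +ℚ t +ℚ R *ℚ T))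
        +ℚ (D - R) *ℚ (D - T) +ℚ (D - C) *ℚ (R - X) +ℚ C *ℚ (C - S) +ℚ (V - U)
      shape = solve-∀ ring

    -- the same when (r , t) ↝ (c , y)
    pair-unequal-large : ∀ {r t y} → d ≤ r → r ≤ c → d ≤ t → t ≤ c → 1 ≤ y → r + t ≡ c + y →
      f (c + r) ≤ℚ join c r → f (c + (d + t)) ≤ℚ join c (d + t) → f (d + t) ≤ℚ join d t →
      join r t ≤ℚ f (r + t) → f (c + y) ≤ℚ join c y → join d y ≤ℚ f (d + y) →
      join c (d + y) ≤ℚ f (c + (d + y)) →
      join (c + r) (c + (d + t)) ≤ℚ join (c + c) (c + (d + y))
    pair-unequal-large {r} {t} {y} d≤r r≤c d≤t t≤c 1≤y e hp hq hs hrt hy hz hn = by-slack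
      (shape (f (c + r)) (f (c + (d + t))) (f (d + t)) (f (c + c)) (f (c + (d + y))) (f (c + y)) (f (d + y))
        (f c) (f d) (f r) (f t) (f y) (φ c) (φ d) (φ r) (φ t) (φ y) (φ (d + t)) (φ (d + y))
        (φ (c + r) *ℚ φ (c + (d + t))) (φ (c + c) *ℚ φ (c + (d + y))))
      -- Now `r + t` yields the third block `c` by itself, and the loose `d` takes the remainder
      -- `y`.
      (slack hp ⊕ slack hq ⊕ slack hs ⊕ slack hcc ⊕ slack hn ⊕ slack hy ⊕ slack hz
        ⊕ slack (subst (λ y → join r t ≤ℚ f y) e hrt)
        ⊕ slack (φ-antitone (ℕ.≤-trans 1≤d d≤r) r≤c) ⊗ slack (φ-antitone (ℕ.≤-trans 1≤d d≤t) t≤c)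
        ⊕ slack (φ-antitone 1≤d d≤c) ⊗ slack (φ-antitone 1≤y y≤t)
        ⊕ φ-nonneg c ⊗ slack (φ-antitone (ℕ.≤-trans 1≤d (ℕ.m≤m+n d y)) (ℕ.+-monoʳ-≤ d y≤t))
        ⊕ slack (exchange-inside (ℕ.+-monoʳ-≤ c r≤c) (ℕ.+-monoʳ-≤ c (ℕ.+-monoʳ-≤ d d≤t)) total))
      where
      y≤t : y ≤ t
      y≤t = ℕ.+-cancelˡ-≤ c y t (subst (_≤ c + t) e (ℕ.+-monoˡ-≤ t r≤c))
      total : c + c + (c + (d + y)) ≡ c + r + (c + (d + t))
      total = trans (lhs d y) (trans (cong (λ y → d + d + (d + d) + d + y) (sym e)) (rhs d r t))
        where
        lhs : ∀ d y → d + d + (d + d) + (d + d + (d + y)) ≡ d + d + (d + d) + d + (d + d + y)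
        lhs = ℕ-Solver.solve-∀
        rhs : ∀ d r t → d + d + (d + d) + d + (r + t) ≡ d + d + r + (d + d + (d + t))
        rhs = ℕ-Solver.solve-∀
      shape : ∀ p q s cc n rt z c d r t y C D R T Y S Z U V → cc +ℚ n +ℚ V - (p +ℚ q +ℚ U) ≡
        (c +ℚ r +ℚ C *ℚ R - p) +ℚ (c +ℚ s +ℚ C *ℚ S - q) +ℚ (d +ℚ t +ℚ D *ℚ T - s)
        +ℚ (cc - (c +ℚ c +ℚ C *ℚ C)) +ℚ (n - (c +ℚ z +ℚ C *ℚ Z)) +ℚ (c +ℚ y +ℚ C *ℚ Y - rt) +ℚ
            (z - (d +ℚ y +ℚ D *ℚ Y)) +ℚ (rt - (r +ℚ t +ℚ R *ℚ T))
        +ℚ (R - C) *ℚ (T - C) +ℚ (D - C) *ℚ (Y - T) +ℚ C *ℚ (Z - S) +ℚ (V - U)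
      shape = solve-∀ ring

    -- ((d , r) , (c , (d , t)))  ↝  ((c , (d , d)) , (r , t))
    pair-halves : ∀ {r t} → d ≤ r → r ≤ c + d → d ≤ t →
      f (d + r) ≤ℚ join d r → f (c + (d + t)) ≤ℚ join c (d + t) → f (d + t) ≤ℚ join d t →
      join r t ≤ℚ f (r + t) →
      join (d + r) (c + (d + t)) ≤ℚ join (c + c) (r + t)
    pair-halves {r} {t} d≤r r≤3d d≤t hp hq hs hrt = by-slack
      (shape (f (d + r)) (f (c + (d + t))) (f (d + t)) (f (c + c)) (f (r + t))
        (f c) (f d) (f r) (f t) (φ c) (φ d) (φ r) (φ t) (φ (d + t))
        (φ (d + r) *ℚ φ (c + (d + t))) (φ (c + c) *ℚ φ (r + t)))
      (slack hp ⊕ slack hq ⊕ slack hs ⊕ slack hcc ⊕ slack hdd ⊕ slack hrt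
        ⊕ slack (φ-antitone 1≤d d≤r) ⊗ slack (φ-antitone 1≤d d≤t)
        ⊕ φ-nonneg c ⊗ slack (φ-antitone (ℕ.≤-trans 1≤d d≤c) (ℕ.+-monoʳ-≤ d d≤t))
        ⊕ slack (exchange-inside (subst (d + r ≤_) (assoc d) (ℕ.+-monoʳ-≤ d r≤3d))
            (ℕ.+-monoʳ-≤ c (ℕ.+-monoʳ-≤ d d≤t)) (total d r t)))
      where
      assoc : ∀ d → d + (d + d + d) ≡ d + d + (d + d)
      assoc = ℕ-Solver.solve-∀
      total : ∀ d r t → d + d + (d + d) + (r + t) ≡ d + r + (d + d + (d + t))
      total = ℕ-Solver.solve-∀
      shape : ∀ p q s cc n c d r t C D R T S U V → cc +ℚ n +ℚ V - (p +ℚ q +ℚ U) ≡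
        (d +ℚ r +ℚ D *ℚ R - p) +ℚ (c +ℚ s +ℚ C *ℚ S - q) +ℚ (d +ℚ t +ℚ D *ℚ T - s)
        +ℚ (cc - (c +ℚ c +ℚ C *ℚ C)) +ℚ (c - (d +ℚ d +ℚ D *ℚ D)) +ℚ (n - (r +ℚ t +ℚ R *ℚ T))
        +ℚ (D - R) *ℚ (D - T) +ℚ C *ℚ (C - S) +ℚ (V - U)
      shape = solve-∀ ring

    -- ((d , r) , (c , s))  ↝  (c , (c , x))   when (r , s) ↝ (d , x)
    pair-crossed-small : ∀ {r s x} → 2 ≤ d → d ≤ r → d ≤ s → s ≤ c → r + s ≡ d + x →
      f (d + r) ≤ℚ join d r → f (c + s) ≤ℚ join c s → join r s ≤ℚ f (r + s) →
      f (d + x) ≤ℚ join d x → join c x ≤ℚ f (c + x) →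
      join (d + r) (c + s) ≤ℚ join c (c + x)
    pair-crossed-small {r} {s} {x} 2≤d d≤r d≤s s≤c e hp hq hrs hx hn = by-slack
      (shape (f (d + r)) (f (c + s)) (f (c + x)) (f (d + x)) (f c) (f d) (f r) (f s) (f x)
        (φ c) (φ d) (φ r) (φ s) (φ x) (φ (d + r) *ℚ φ (c + s)) (φ c *ℚ φ (c + x)))
      (slack hp ⊕ slack hq ⊕ slack hdd ⊕ slack hn ⊕ slack hx
        ⊕ slack (subst (λ y → join r s ≤ℚ f y) e hrs)
        ⊕ slack (φ-antitone 1≤d d≤r) ⊗ slack (φ-antitone 1≤d d≤s)
        ⊕ slack (subst (_≤ℚ (φ d - φ c) *ℚ (φ s - φ x)) (sym exch) gain))
      where
      s≤x : s ≤ x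
      s≤x = ℕ.+-cancelˡ-≤ d s x (subst (d + s ≤_) e (ℕ.+-monoˡ-≤ s d≤r))
      ιr-ιd : ι r - ι d ≡ ι x - ι s
      ιr-ιd = trans (lhs (ι r) (ι s) (ι d))
          (trans (cong (λ y → y - ι s - ι d) (trans (sym (ι-+ r s)) (trans (cong ι e) (ι-+ d x))))
          (rhs (ι d) (ι x) (ι s)))
        where
        lhs : ∀ r s d → r - d ≡ r +ℚ s - s - d
        lhs = solve-∀ ring
        rhs : ∀ d x s → d +ℚ x - s - d ≡ x - s
        rhs = solve-∀ ring
      m : ℕ
      m = d + r + (c + s)
      total : c + (c + x) ≡ m
      total = trans (lhs d x) (trans (cong (λ y → d + d + d + y) (sym e)) (rhs d r s))
        where
        lhs : ∀ d x → d + d + (d + d + x) ≡ d + d + d + (d + x)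
        lhs = ℕ-Solver.solve-∀
        rhs : ∀ d r s → d + d + d + (r + s) ≡ d + r + (d + d + s)
        rhs = ℕ-Solver.solve-∀
      -- The new part `c` is no larger than either old part, so this is a loss; `r + s = d + x`
      -- turns the factor `r - d` into `x - s`.
      exch : φ (d + r) *ℚ φ (c + s) - φ c *ℚ φ (c + x) ≡ (ι x - ι s) *ℚ (ι s *ℚ ε m)
      exch = trans (exchange (d + r) (c + s) c (c + x) total)
             (trans (cong₂ (λ x y → x *ℚ y *ℚ ε m)
                      (cong₂ _-_ (ι-+ d d) (ι-+ d r)) (cong (λ z → ι c - z) (ι-+ c s)))
             (trans (simp (ι d) (ι r) (ι c) (ι s) (ε m)) (cong (_*ℚ (ι s *ℚ ε m)) ιr-ιd)))
        where
        simp : ∀ d r c s e → (d +ℚ d - (d +ℚ r)) *ℚ (c - (c +ℚ s)) *ℚ e ≡ (r - d) *ℚ (s *ℚ e)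
        simp = solve-∀ ring
      x≤ : c + x ≤ d + (d + r + c)
      x≤ = begin
        d + d + x          ≡⟨ lhs d x ⟩
        d + (d + x)        ≡⟨ cong (d +_) e ⟨
        d + (r + s)        ≤⟨ ℕ.+-monoʳ-≤ d (ℕ.+-monoʳ-≤ r (ℕ.≤-trans s≤c (ℕ.m≤n+m c d))) ⟩
        d + (r + (d + c))  ≡⟨ rhs d r c ⟩
        d + (d + r + c)    ∎
        where
        open ℕ.≤-Reasoning
        lhs : ∀ d x → d + d + x ≡ d + (d + x)
        lhs = ℕ-Solver.solve-∀
        rhs : ∀ d r c → d + (r + (d + c)) ≡ d + (d + r + c)
        rhs = ℕ-Solver.solve-∀
      -- Two uses of `φ-gap` give `(c - d)(x - s) / 2^(c + x)` with `c - d = d`. The factor `s` of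
      -- the loss is traded for `d` by splitting `ε s` off `ε m` and using `φ s ≤ φ d`; by `x≤` the
      -- denominator remains large enough.
      gain : (ι x - ι s) *ℚ (ι s *ℚ ε m) ≤ℚ (φ d - φ c) *ℚ (φ s - φ x)
      gain = begin
        (ι x - ι s) *ℚ (ι s *ℚ ε m)
          ≡⟨ cong (λ y → (ι x - ι s) *ℚ (ι s *ℚ y)) (trans (cong ε (order d r c s)) (ε-+ s (d + r + c))) ⟩
        (ι x - ι s) *ℚ (ι s *ℚ (ε s *ℚ ε (d + r + c)))
          ≡⟨ cong ((ι x - ι s) *ℚ_) (*-assoc (ι s) (ε s) _) ⟨
        (ι x - ι s) *ℚ (φ s *ℚ ε (d + r + c))
          ≤⟨ *-monoˡ-≤-nonNeg (ι x - ι s) ⦃ nonNegative (slack (ι-mono s≤x)) ⦄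
              (*ε-mono (d + r + c) (φ-antitone 1≤d d≤s)) ⟩
        (ι x - ι s) *ℚ (ι d *ℚ ε d *ℚ ε (d + r + c))
          ≡⟨ cong ((ι x - ι s) *ℚ_) (trans (*-assoc (ι d) (ε d) _) (cong (ι d *ℚ_) (sym (ε-+ d (d + r + c))))) ⟩
        (ι x - ι s) *ℚ (ι d *ℚ ε (d + (d + r + c)))
          ≤⟨ *-monoˡ-≤-nonNeg (ι x - ι s) ⦃ nonNegative (slack (ι-mono s≤x)) ⦄
              (*-monoˡ-≤-nonNeg (ι d) ⦃ nonNegative (ι-nonneg d) ⦄ (ε-antitone x≤)) ⟩
        (ι x - ι s) *ℚ (ι d *ℚ ε (c + x))
          ≡⟨ cong (λ y → (ι x - ι s) *ℚ (ι d *ℚ y)) (ε-+ c x) ⟩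
        (ι x - ι s) *ℚ (ι d *ℚ (ε c *ℚ ε x))
          ≡⟨ regroup (ι d) (ι x) (ι s) (ε c) (ε x) ⟩
        ((ι d +ℚ ι d - ι d) *ℚ ε c) *ℚ ((ι x - ι s) *ℚ ε x)
          ≡⟨ cong (λ y → ((y - ι d) *ℚ ε c) *ℚ ((ι x - ι s) *ℚ ε x)) (ι-+ d d) ⟨
        ((ι c - ι d) *ℚ ε c) *ℚ ((ι x - ι s) *ℚ ε x)
          ≤⟨ *-mono-≤-nonneg (slack (ι-mono d≤c) ⊗ ε-nonneg c) (slack (ι-mono s≤x) ⊗ ε-nonneg x) (φ-gap 2≤d d≤c)
              (φ-gap (ℕ.≤-trans 2≤d d≤s) s≤x) ⟩
        (φ d - φ c) *ℚ (φ s - φ x) ∎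
        where
        open ≤-Reasoning
        order : ∀ d r c s → d + r + (c + s) ≡ s + (d + r + c)
        order = ℕ-Solver.solve-∀
        regroup : ∀ d x s e e′ → (x - s) *ℚ (d *ℚ (e *ℚ e′)) ≡ ((d +ℚ d - d) *ℚ e) *ℚ ((x - s) *ℚ e′)
        regroup = solve-∀ ring
      shape : ∀ p q n rs c d r s x C D R S X U V → c +ℚ n +ℚ V - (p +ℚ q +ℚ U) ≡
        (d +ℚ r +ℚ D *ℚ R - p) +ℚ (c +ℚ s +ℚ C *ℚ S - q) +ℚ (c - (d +ℚ d +ℚ D *ℚ D)) +ℚ (n - (c +ℚ x +ℚ C *ℚ X))
        +ℚ (d +ℚ x +ℚ D *ℚ X - rs) +ℚ (rs - (r +ℚ s +ℚ R *ℚ S))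
        +ℚ (D - R) *ℚ (D - S) +ℚ ((D - C) *ℚ (S - X) - (U - V))
      shape = solve-∀ ring

    -- the same when (r , s) ↝ (c , y)
    pair-crossed-large : ∀ {r s y} → 2 ≤ d → 2 ≤ y → d ≤ r → r ≤ c → d ≤ s → s ≤ c → r + s ≡ c + y →
      f (d + r) ≤ℚ join d r → f (c + s) ≤ℚ join c s → join r s ≤ℚ f (r + s) →
      f (c + y) ≤ℚ join c y → join d y ≤ℚ f (d + y) →
      join (d + r) (c + s) ≤ℚ join (c + c) (d + y)
    pair-crossed-large {r} {s} {y} 2≤d 2≤y d≤r r≤c d≤s s≤c e hp hq hrs hy hn = by-slack
      (shape (f (d + r)) (f (c + s)) (f (c + c)) (f (d + y)) (f (c + y)) (f c) (f d) (f r) (f s) (f y)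
        (φ c) (φ d) (φ r) (φ s) (φ y) (φ (d + r) *ℚ φ (c + s)) (φ (c + c) *ℚ φ (d + y)))
      (slack hp ⊕ slack hq ⊕ slack hcc ⊕ slack hn ⊕ slack hy
        ⊕ slack (subst (λ y → join r s ≤ℚ f y) e hrs)
        ⊕ slack (φ-antitone (ℕ.≤-trans 1≤d d≤r) r≤c) ⊗ slack (φ-antitone (ℕ.≤-trans 1≤d d≤s) s≤c)
        ⊕ slack (subst (_≤ℚ (φ d - φ c) *ℚ (φ y - φ r)) (sym exch) gain))
      where
      y≤r : y ≤ r
      y≤r = ℕ.+-cancelʳ-≤ c y r (subst (_≤ r + c) (trans e (ℕ.+-comm c y)) (ℕ.+-monoʳ-≤ r s≤c))
      ιc-ιs : ι c - ι s ≡ ι r - ι y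
      ιc-ιs = trans (lhs (ι c) (ι y) (ι s))
          (trans (cong (λ z → z - ι s - ι y) (trans (sym (ι-+ c y)) (trans (cong ι (sym e)) (ι-+ r s))))
          (rhs (ι r) (ι s) (ι y)))
        where
        lhs : ∀ c y s → c - s ≡ c +ℚ y - s - y
        lhs = solve-∀ ring
        rhs : ∀ r s y → r +ℚ s - s - y ≡ r - y
        rhs = solve-∀ ring
      m : ℕ
      m = d + r + (c + s)
      total : c + c + (d + y) ≡ m
      total = trans (lhs d y) (trans (cong (λ y → d + d + d + y) (sym e)) (rhs d r s))
        where
        lhs : ∀ d y → d + d + (d + d) + (d + y) ≡ d + d + d + (d + d + y)
        lhs = ℕ-Solver.solve-∀
        rhs : ∀ d r s → d + d + d + (r + s) ≡ d + r + (d + d + s)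
        rhs = ℕ-Solver.solve-∀
      -- Again a loss, as `c + c` is at least as large as both old parts; `r + s = c + y` makes
      -- `c - s` equal to `r - y`.
      exch : φ (d + r) *ℚ φ (c + s) - φ (c + c) *ℚ φ (d + y) ≡ (ι c +ℚ (ι d - ι r)) *ℚ ((ι r - ι y) *ℚ ε m)
      exch = trans (exchange (d + r) (c + s) (c + c) (d + y) total)
             (trans (cong₂ (λ x y → x *ℚ y *ℚ ε m)
                      (cong₂ _-_ (trans (ι-+ c c) (cong (ι c +ℚ_) (ι-+ d d))) (ι-+ d r))
                          (cong₂ _-_ (ι-+ c c) (ι-+ c s)))
             (trans (simp (ι d) (ι r) (ι c) (ι s) (ε m))
                 (cong (λ z → (ι c +ℚ (ι d - ι r)) *ℚ (z *ℚ ε m)) ιc-ιs)))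
        where
        simp : ∀ d r c s e → (c +ℚ (d +ℚ d) - (d +ℚ r)) *ℚ (c +ℚ c - (c +ℚ s)) *ℚ e ≡ (c +ℚ (d - r)) *ℚ
            ((c - s) *ℚ e)
        simp = solve-∀ ring
      0≤rye : ∀ n → 0ℚ ≤ℚ (ι r - ι y) *ℚ ε n
      0≤rye n = slack (ι-mono y≤r) ⊗ ε-nonneg n
      -- The first factor is at most `c` because `d ≤ r`. Then `φ c ≤ φ d` trades it for `d`, which
      -- is `c - d`, and the powers of two left over suffice for `ε c * ε r`.
      gain : (ι c +ℚ (ι d - ι r)) *ℚ ((ι r - ι y) *ℚ ε m) ≤ℚ (φ d - φ c) *ℚ (φ y - φ r)
      gain = begin
        (ι c +ℚ (ι d - ι r)) *ℚ ((ι r - ι y) *ℚ ε m)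
          ≤⟨ *-monoʳ-≤-nonNeg ((ι r - ι y) *ℚ ε m) ⦃ nonNegative (0≤rye m) ⦄
              (by-slack {ι c +ℚ (ι d - ι r)} {ι c} (drop (ι c) (ι d) (ι r)) (slack (ι-mono d≤r))) ⟩
        ι c *ℚ ((ι r - ι y) *ℚ ε m)
          ≡⟨ cong (λ z → ι c *ℚ ((ι r - ι y) *ℚ z)) (trans (cong ε (order d r c s)) (ε-+ c (d + r + s))) ⟩
        ι c *ℚ ((ι r - ι y) *ℚ (ε c *ℚ ε (d + r + s)))
          ≡⟨ assoc (ι c) (ι r - ι y) (ε c) (ε (d + r + s)) ⟩
        φ c *ℚ ((ι r - ι y) *ℚ ε (d + r + s))
          ≤⟨ *-monoʳ-≤-nonNeg ((ι r - ι y) *ℚ ε (d + r + s)) ⦃ nonNegative (0≤rye (d + r + s)) ⦄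
              (φ-antitone 1≤d d≤c) ⟩
        φ d *ℚ ((ι r - ι y) *ℚ ε (d + r + s))
          ≤⟨ *-monoˡ-≤-nonNeg (φ d) ⦃ nonNegative (φ-nonneg d) ⦄
              (*-monoˡ-≤-nonNeg (ι r - ι y) ⦃ nonNegative (slack (ι-mono y≤r)) ⦄
              (ε-antitone {d + r} (ℕ.m≤m+n (d + r) s))) ⟩
        φ d *ℚ ((ι r - ι y) *ℚ ε (d + r))
          ≡⟨ cong (λ z → φ d *ℚ ((ι r - ι y) *ℚ z)) (ε-+ d r) ⟩
        φ d *ℚ ((ι r - ι y) *ℚ (ε d *ℚ ε r))
          ≡⟨ regroup (ι d) (ι r) (ι y) (ε d) (ε r) ⟩
        ((ι d +ℚ ι d - ι d) *ℚ (ε d *ℚ ε d)) *ℚ ((ι r - ι y) *ℚ ε r)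
          ≡⟨ cong₂ (λ z w → ((z - ι d) *ℚ w) *ℚ ((ι r - ι y) *ℚ ε r)) (ι-+ d d) (ε-+ d d) ⟨
        ((ι c - ι d) *ℚ ε c) *ℚ ((ι r - ι y) *ℚ ε r)
          ≤⟨ *-mono-≤-nonneg (slack (ι-mono d≤c) ⊗ ε-nonneg c) (slack (ι-mono y≤r) ⊗ ε-nonneg r) (φ-gap 2≤d d≤c)
              (φ-gap 2≤y y≤r) ⟩
        (φ d - φ c) *ℚ (φ y - φ r) ∎
        where
        open ≤-Reasoning
        drop : ∀ c d r → c - (c +ℚ (d - r)) ≡ r - d
        drop = solve-∀ ring
        order : ∀ d r c s → d + r + (c + s) ≡ c + (d + r + s)
        order = ℕ-Solver.solve-∀
        assoc : ∀ c x e e′ → c *ℚ (x *ℚ (e *ℚ e′)) ≡ c *ℚ e *ℚ (x *ℚ e′)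
        assoc = solve-∀ ring
        regroup : ∀ d r y e e′ → d *ℚ e *ℚ ((r - y) *ℚ (e *ℚ e′)) ≡ ((d +ℚ d - d) *ℚ (e *ℚ e)) *ℚ
            ((r - y) *ℚ e′)
        regroup = solve-∀ ring
      shape : ∀ p q cc n rs c d r s y C D R S Y U V → cc +ℚ n +ℚ V - (p +ℚ q +ℚ U) ≡
        (d +ℚ r +ℚ D *ℚ R - p) +ℚ (c +ℚ s +ℚ C *ℚ S - q) +ℚ (cc - (c +ℚ c +ℚ C *ℚ C)) +ℚ
            (n - (d +ℚ y +ℚ D *ℚ Y))
        +ℚ (c +ℚ y +ℚ C *ℚ Y - rs) +ℚ (rs - (r +ℚ s +ℚ R *ℚ S))
        +ℚ (R - C) *ℚ (S - C) +ℚ ((D - C) *ℚ (Y - R) - (U - V))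
      shape = solve-∀ ring

-- Powers of two and the recursion

-- Linear arithmetic by certificate: A ≤ B is a sum of hypotheses, c the excess, and e is left to the ring solver.
linear : ∀ {A B x y} c → A ≤ B → x + B + c ≡ y + A → x ≤ y
linear {A} {B} {x} {y} c A≤B e = ℕ.+-cancelʳ-≤ A x y (begin
  x + A      ≤⟨ ℕ.+-monoʳ-≤ x A≤B ⟩
  x + B      ≤⟨ ℕ.m≤m+n (x + B) c ⟩
  x + B + c  ≡⟨ e ⟩
  y + A      ∎)
  where open ℕ.≤-Reasoning

absurd : ∀ {A B} → suc A ≤ B → B ≤ A → ∀ {ℓ} {X : Set ℓ} → X
absurd p q = ⊥-elim (ℕ.<⇒≱ p q)

halve-≤ : ∀ {a b} → a + a ≤ b + b → a ≤ b
halve-≤ {a} {b} p with a ℕ.≤? b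
... | yes q = q
... | no q = absurd (ℕ.+-mono-< (ℕ.≰⇒> q) (ℕ.≰⇒> q)) p

Power : ℕ → Set
Power c = ∃[ k ] c ≡ 2 ^ k

2^suc : ∀ k → 2 ^ suc k ≡ 2 ^ k + 2 ^ k
2^suc k = cong (2 ^ k +_) (ℕ.+-identityʳ (2 ^ k))

Power-double : ∀ {c} → Power c → Power (c + c)
Power-double (k , refl) = suc k , sym (2^suc k)

Power-positive : ∀ {c} → Power c → 1 ≤ c
Power-positive (k , refl) = ℕ.≤-trans (s≤s z≤n) (1+d≤2^d k)

2^-gap : ∀ {j k} → j < k → 2 ^ j + 2 ^ j ≤ 2 ^ k
2^-gap {j} {k} j<k = subst (_≤ 2 ^ k) (2^suc j) (ℕ.^-monoʳ-≤ 2 j<k)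

Power-compare : ∀ {a b} → Power a → Power b → a ≤ b ⊎ b + b ≤ a
Power-compare (j , refl) (k , refl) with j ℕ.≤? k
... | yes j≤k = inj₁ (ℕ.^-monoʳ-≤ 2 j≤k)
... | no j≰k = inj₂ (2^-gap (ℕ.≰⇒> j≰k))

-- For `n = c + s` this is the window `3c/2 ≤ n < 3c` of the theorem, free of halves. The windows of
-- consecutive powers of two abut, so every `n ≥ 2` lies in exactly one.
Balanced : ℕ → ℕ → Set
Balanced c s = c ≤ s + s × s < c + c

-- The argument `i` stands for the size `i + 2`; the result is the exponent of `c` together with
-- `s`. Counting up increases `s` until it would reach `2c`, and then carries `c + 2c` over to
-- `2c + c`.
decompose : ℕ → ℕ × ℕ
decompose zero    = 0 , 1
decompose (suc i) with k , s ← decompose i =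
  if suc s <ᵇ 2 ^ k + 2 ^ k then (k , suc s) else (suc k , 2 ^ k)

module _ (i : ℕ) where
  pow rest : ℕ
  pow  = 2 ^ proj₁ (decompose i)
  rest = proj₂ (decompose i)

decompose-correct : ∀ i → pow i + rest i ≡ suc (suc i) × Balanced (pow i) (rest i)
decompose-correct zero = refl , s≤s z≤n , s≤s (s≤s z≤n)
decompose-correct (suc i)
  with k , s ← decompose i | e , c≤2s , s<2c ← decompose-correct i
  with suc s <ᵇ 2 ^ k + 2 ^ k in small
... | true  = trans (ℕ.+-suc (2 ^ k) s) (cong suc e)
            , ℕ.≤-trans c≤2s (ℕ.+-mono-≤ (ℕ.n≤1+n s) (ℕ.n≤1+n s))
            , ℕ.<ᵇ⇒< (suc s) _ (subst T (sym small) _)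
... | false = trans (cong (_+ 2 ^ k) (2^suc k))
    (trans (trans (ℕ.+-assoc (2 ^ k) _ _) (cong (2 ^ k +_) (sym 1+s≡2c)))
    (trans (ℕ.+-suc (2 ^ k) s) (cong suc e)))
            , ℕ.≤-reflexive (2^suc k)
            , subst (λ x → 2 ^ k < x + x) (sym (2^suc k)) (c<4c _ (ℕ.m^n>0 2 k))
  where
  1+s≡2c : suc s ≡ 2 ^ k + 2 ^ k
  1+s≡2c = ℕ.≤-antisym s<2c (ℕ.≮⇒≥ λ p → subst T small (ℕ.<⇒<ᵇ p))
  c<4c : ∀ c → 0 < c → c < c + c + (c + c)
  c<4c c 0<c = linear (c + c) 0<c (ℕ-Solver.solve (c ∷ []))

-- With `a = 2 ^ j`, `b = 2 ^ k` and `2a ≤ b`, the first size is below `3a ≤ 3b/2` and the second is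
-- at least `3b/2`.
Balanced-exponent-≮ : ∀ {j k s t} → Balanced (2 ^ j) s → Balanced (2 ^ k) t →
                      2 ^ j + s ≡ 2 ^ k + t → ¬ j < k
Balanced-exponent-≮ {j} {k} {s} {t} (_ , s<2c) (c≤2t , _) e j<k =
  go (2 ^ j) (2 ^ k) s<2c c≤2t (2^-gap j<k) e
  where
  go : ∀ a b → s < a + a → b ≤ t + t → a + a ≤ b → ¬ a + s ≡ b + t
  go a b p q r e = ℕ.<-irrefl (cong₂ _+_ e e)
      (linear 1 (ℕ.+-mono-≤ (ℕ.+-mono-≤ p p) (ℕ.+-mono-≤ q (ℕ.+-mono-≤ r (ℕ.+-mono-≤ r r))))
      (ℕ-Solver.solve (a ∷ b ∷ s ∷ t ∷ [])))

Balanced-exponent-unique : ∀ {j k s t} → Balanced (2 ^ j) s → Balanced (2 ^ k) t →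
                           2 ^ j + s ≡ 2 ^ k + t → j ≡ k
Balanced-exponent-unique {j} {k} x y e with ℕ.<-cmp j k
... | tri< j<k _ _ = ⊥-elim (Balanced-exponent-≮ x y e j<k)
... | tri≈ _ j≡k _ = j≡k
... | tri> _ _ k<j = ⊥-elim (Balanced-exponent-≮ y x (sym e) k<j)

node : (p q a b : ℕ) → ℕ
node p q a b = 2 ^ q * a + 2 ^ p * b + p * q

-- H′ g agrees with H up to size g.  At the exceptional size 6 the best split is 3 + 3, of weight node 3 3 4 4 = 73.
H′ : ℕ → ℕ → ℕ
H′ zero    _             = 0
H′ (suc g) zero          = 0
H′ (suc g) (suc zero)    = 0
H′ (suc g) (suc (suc i)) =
  if i ≡ᵇ 4 then 73 else node (pow i) (rest i) (H′ g (pow i)) (H′ g (rest i))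

H : ℕ → ℕ
H n = H′ n n

pow-positive : ∀ i → 1 ≤ pow i
pow-positive i = ℕ.m^n>0 2 (proj₁ (decompose i))

positive-half : ∀ {c s} → 1 ≤ c → c ≤ s + s → 1 ≤ s
positive-half {c} {zero}  p q = ℕ.≤-trans p q
positive-half {c} {suc s} p q = s≤s z≤n

pow≤ : ∀ i → pow i ≤ suc i
pow≤ i with e , c≤2s , _ ← decompose-correct i = go (pow i) (rest i) e (positive-half (pow-positive i) c≤2s)
  where
  go : ∀ c s → c + s ≡ suc (suc i) → 1 ≤ s → c ≤ suc i
  go c (suc s) e _ = ℕ.≤-trans (ℕ.m≤m+n c s) (ℕ.≤-reflexive (ℕ.suc-injective (trans (sym (ℕ.+-suc c s)) e)))

rest≤ : ∀ i → rest i ≤ suc i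
rest≤ i with e , _ ← decompose-correct i = go (pow i) (rest i) e (pow-positive i)
  where
  go : ∀ c s → c + s ≡ suc (suc i) → 1 ≤ c → s ≤ suc i
  go (suc c) s e _ = ℕ.≤-trans (ℕ.m≤n+m s c) (ℕ.≤-reflexive (ℕ.suc-injective e))

-- `H` starts with its own size as fuel, so its subcalls run with more fuel than their size; this
-- identifies them with values of `H` again.
H′-fuel : ∀ g g′ n → n ≤ g → n ≤ g′ → H′ g n ≡ H′ g′ n
H′-fuel zero    zero     n             p       q        = refl
H′-fuel zero    (suc g′) zero          p       q        = refl
H′-fuel (suc g) zero     zero          p       q        = refl
H′-fuel (suc g) (suc g′) zero          p       q        = refl
H′-fuel (suc g) (suc g′) (suc zero)    p       q        = refl
H′-fuel (suc g) (suc g′) (suc (suc i)) (s≤s p) (s≤s q) =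
  cong₂ (λ a b → if i ≡ᵇ 4 then 73 else node (pow i) (rest i) a b)
    (H′-fuel g g′ (pow i) (ℕ.≤-trans (pow≤ i) p) (ℕ.≤-trans (pow≤ i) q))
    (H′-fuel g g′ (rest i) (ℕ.≤-trans (rest≤ i) p) (ℕ.≤-trans (rest≤ i) q))

H-node : ∀ k s → Balanced (2 ^ k) s → 2 ^ k + s ≢ 6 →
         H (2 ^ k + s) ≡ node (2 ^ k) s (H (2 ^ k)) (H s)
-- The size becomes a variable, so that it can be matched against the clauses of `H′`.
H-node k s bal ≢6 = go (2 ^ k + s) refl
  where
  1≤s : 1 ≤ s
  1≤s = positive-half (ℕ.m^n>0 2 k) (proj₁ bal)
  go : ∀ n → n ≡ 2 ^ k + s → H n ≡ node (2 ^ k) s (H (2 ^ k)) (H s)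
  go zero e = absurd (subst (1 ≤_) (sym e) (ℕ.≤-trans 1≤s (ℕ.m≤n+m s (2 ^ k)))) z≤n
  go (suc zero) e = absurd (subst (2 ≤_) (sym e) (ℕ.+-mono-≤ (ℕ.m^n>0 2 k) 1≤s)) (s≤s z≤n)
  go (suc (suc i)) e with i ≡ᵇ 4 in is-4
  ... | true  = ⊥-elim (≢6 (trans (sym e) (cong (λ x → suc (suc x)) (ℕ.≡ᵇ⇒≡ i 4 (subst T (sym is-4) _)))))
  ... | false = trans
    (cong₂ (node (pow i) (rest i)) (H′-fuel (suc i) (pow i) (pow i) (pow≤ i) ℕ.≤-refl)
        (H′-fuel (suc i) (rest i) (rest i) (rest≤ i) ℕ.≤-refl))
    (cong₂ (λ p q → node p q (H p) (H q)) pow≡ rest≡)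
    where
    spec = decompose-correct i
    same : pow i + rest i ≡ 2 ^ k + s
    same = trans (proj₁ spec) e
    pow≡ : pow i ≡ 2 ^ k
    pow≡ = cong (2 ^_) (Balanced-exponent-unique {proj₁ (decompose i)} {k} (proj₂ spec) bal same)
    rest≡ : rest i ≡ s
    rest≡ = ℕ.+-cancelˡ-≡ (2 ^ k) (rest i) s (trans (cong (_+ rest i) (sym pow≡)) same)

-- Superadditivity

node-superadditive-small : ∀ {p} → p < 11 → ∀ {q} → q < 11 →
  node (suc p) (suc q) (H (suc p)) (H (suc q)) ≤ H (suc p + suc q)
node-superadditive-small = from-yes (ℕ.allUpTo? (λ p → ℕ.allUpTo? (λ q →
  node (suc p) (suc q) (H (suc p)) (H (suc q)) ℕ.≤? H (suc p + suc q)) 11) 11)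

f : ℕ → ℚ
f n = ι (H n) *ℚ ε n

open Rotations f

ι-node : ∀ p q a b → ι (node p q a b) ≡ ι (2 ^ q) *ℚ ι a +ℚ ι (2 ^ p) *ℚ ι b +ℚ ι p *ℚ ι q
ι-node p q a b = trans (ι-+ (2 ^ q * a + 2 ^ p * b) (p * q))
  (cong₂ _+ℚ_ (trans (ι-+ (2 ^ q * a) (2 ^ p * b)) (cong₂ _+ℚ_ (ι-* (2 ^ q) a) (ι-* (2 ^ p) b))) (ι-* p q))

node-scaled : ∀ p q a b → ι (node p q a b) *ℚ ε (p + q) ≡ ι a *ℚ ε p +ℚ ι b *ℚ ε q +ℚ φ p *ℚ φ q
node-scaled p q a b = begin
  ι (2 ^ q * a + 2 ^ p * b + p * q) *ℚ ε (p + q)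
    ≡⟨ cong₂ _*ℚ_ (ι-node p q a b) (ε-+ p q) ⟩
  (Q *ℚ ι a +ℚ P *ℚ ι b +ℚ ι p *ℚ ι q) *ℚ (ε p *ℚ ε q)
    ≡⟨ collect P Q (ι a) (ι b) (ι p) (ι q) (ε p) (ε q) ⟩
  (Q *ℚ ε q) *ℚ (ι a *ℚ ε p) +ℚ (P *ℚ ε p) *ℚ (ι b *ℚ ε q) +ℚ φ p *ℚ φ q
    ≡⟨ cong₂ (λ x y → x *ℚ (ι a *ℚ ε p) +ℚ y *ℚ (ι b *ℚ ε q) +ℚ φ p *ℚ φ q) (ι*ε q) (ι*ε p) ⟩
  1ℚ *ℚ (ι a *ℚ ε p) +ℚ 1ℚ *ℚ (ι b *ℚ ε q) +ℚ φ p *ℚ φ q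
    ≡⟨ cong₂ (λ x y → x +ℚ y +ℚ φ p *ℚ φ q) (*-identityˡ (ι a *ℚ ε p)) (*-identityˡ (ι b *ℚ ε q)) ⟩
  ι a *ℚ ε p +ℚ ι b *ℚ ε q +ℚ φ p *ℚ φ q ∎
  where
  open ≡-Reasoning
  P Q : ℚ
  P = ι (2 ^ p)
  Q = ι (2 ^ q)
  collect : ∀ P Q a b p q e e′ → (Q *ℚ a +ℚ P *ℚ b +ℚ p *ℚ q) *ℚ (e *ℚ e′) ≡ (Q *ℚ e′) *ℚ (a *ℚ e) +ℚ (P *ℚ e)
      *ℚ (b *ℚ e′) +ℚ (p *ℚ e) *ℚ (q *ℚ e′)
  collect = solve-∀ ring

f-node : ∀ {c s} → Power c → Balanced c s → c + s ≢ 6 → f (c + s) ≡ join c s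
f-node {s = s} (k , refl) bal ≢6 =
  trans (cong (λ h → ι h *ℚ ε (2 ^ k + s)) (H-node k s bal ≢6)) (node-scaled (2 ^ k) s (H (2 ^ k)) (H s))

f-node′ : ∀ {c s} → Power c → Balanced c s → 7 ≤ c + s → f (c + s) ≡ join c s
f-node′ pc bal 7≤ = f-node pc bal λ e → absurd 7≤ (ℕ.≤-reflexive e)

balanced-split : ∀ {n} → 2 ≤ n → ∃[ c ] ∃[ s ] c + s ≡ n × Power c × Balanced c s
balanced-split {suc (suc i)} (s≤s (s≤s _)) with e , bal ← decompose-correct i = pow i , rest i , e ,
    (proj₁ (decompose i) , refl) , bal

Power-halve : ∀ {c} → Power c → 2 ≤ c → ∃[ d ] Power d × d + d ≡ c
Power-halve (zero  , refl) (s≤s ())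
Power-halve (suc k , refl) _ = 2 ^ k , (k , refl) , sym (2^suc k)

via : ∀ {a b m : ℕ} → a ≡ m → b ≡ a → b ≡ m
via p q = trans q p

-- The inductive step of superadditivity

module Step {m : ℕ} (13≤m : 13 ≤ m)
  (ih′ : ∀ {p q} → 1 ≤ p → 1 ≤ q → p + q < m → join p q ≤ℚ f (p + q)) where

  -- The argument `r` is the total size of the pieces outside `p` and `q`; naming it turns the
  -- descent `p + q < m` into an identity for the ring solver.
  ih : ∀ p q r → 1 ≤ p → 1 ≤ q → 1 ≤ r → p + q + r ≡ m → join p q ≤ℚ f (p + q)
  ih p q r 1≤p 1≤q 1≤r refl = ih′ 1≤p 1≤q (linear 0 1≤r (ℕ-Solver.solve (p ∷ q ∷ r ∷ [])))

  upper : ∀ {c s} → Power c → Balanced c s → 7 ≤ c + s → f (c + s) ≤ℚ join c s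
  upper pc bal 7≤ = ≤-reflexive (f-node′ pc bal 7≤)

  optimal : ∀ c s → Power c → Balanced c s → c + s ≡ m → join c s ≤ℚ f m
  optimal c s pc bal refl = ≤-reflexive (sym (f-node′ pc bal (ℕ.≤-trans (ℕ.m≤n+m 7 6) 13≤m)))

  -- (c , (c , u))  ↝  ((c , c) , u)
  merge : ∀ {c u} → Power c → c ≤ u → u < c + c → c + (c + u) ≡ m → join c (c + u) ≤ℚ f m
  merge {c} {u} pc c≤u u<2c e = begin
    join c (c + u)
      ≡⟨ cong (join c) (ℕ.+-comm c u) ⟩
    join c (u + c)
      ≤⟨ rotate {t = c} 1≤c c≤u (subst₂ _≤ℚ_ (cong f (ℕ.+-comm c u)) (join-comm c u)
          (upper pc (ℕ.≤-trans c≤u (ℕ.m≤m+n u u) , u<2c) 7≤))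
          (ih c c u 1≤c 1≤c 1≤u (via e (ℕ-Solver.solve (c ∷ u ∷ [])))) ⟩
    join u (c + c)
      ≡⟨ join-comm u (c + c) ⟩
    join (c + c) u
      ≤⟨ optimal (c + c) u (Power-double pc)
          (ℕ.+-mono-≤ c≤u c≤u , linear (c + c) u<2c (ℕ-Solver.solve (c ∷ u ∷ [])))
          (via e (ℕ-Solver.solve (c ∷ u ∷ []))) ⟩
    f m ∎
    where
    open ≤-Reasoning
    1≤c = Power-positive pc
    1≤u = ℕ.≤-trans 1≤c c≤u
    13≤ : 13 ≤ c + (c + u)
    13≤ = subst (13 ≤_) (sym e) 13≤m
    7≤ : 7 ≤ c + u
    7≤ = halve-≤ (linear 0 (ℕ.+-mono-≤ 13≤ 1≤u) (ℕ-Solver.solve (c ∷ u ∷ [])))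

  -- The position of `n` relative to the window of `c` decides. Inside it the split is the
  -- prescribed one. If `n` is too small, one half of `c` is handed over to it. If `n` is too large,
  -- it is opened at its own power `b`, which then takes the place of `c` at the root.
  power-join : ∀ {c n} → Power c → 1 ≤ n → c + n ≡ m → join c n ≤ℚ f m
  power-join {c} {n} pc 1≤n e with n ℕ.<? c + c | c ℕ.≤? n + n
  ... | yes n<2c | yes c≤2n = optimal c n pc (c≤2n , n<2c) e
  ... | yes n<2c | no c≰2n = split-power
      (Power-halve pc (linear 1 (ℕ.+-mono-≤ c>2n (ℕ.+-mono-≤ 1≤n 1≤n)) (ℕ-Solver.solve (c ∷ n ∷ []))))
    where
    c>2n : n + n < c
    c>2n = ℕ.≰⇒> c≰2n
    split-power : ∃[ d ] Power d × d + d ≡ c → join c n ≤ℚ f m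
    split-power (d , pd , refl) = begin
      join (d + d) n
        ≡⟨ join-comm (d + d) n ⟩
      join n (d + d)
        ≤⟨ rotate {t = d} 1≤n (ℕ.<⇒≤ n<d) (upper pd (ℕ.m≤m+n d d , ℕ.m<m+n d 1≤d) 7≤2d)
            (ih n d d 1≤n 1≤d 1≤d (via e (ℕ-Solver.solve (d ∷ n ∷ [])))) ⟩
      join d (n + d)
        ≤⟨ optimal d (n + d) pd (linear (n + n + d) (z≤n {0}) (ℕ-Solver.solve (d ∷ n ∷ [])) , ℕ.+-monoˡ-< d n<d)
            (via e (ℕ-Solver.solve (d ∷ n ∷ []))) ⟩
      f m ∎
      where
      open ≤-Reasoning
      1≤d = Power-positive pd
      n<d : n < d
      n<d = ℕ.≰⇒> λ d≤n → absurd c>2n (ℕ.+-mono-≤ d≤n d≤n)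
      13≤ : 13 ≤ d + d + n
      13≤ = subst (13 ≤_) (sym e) 13≤m
      7≤2d : 7 ≤ d + d
      7≤2d = halve-≤ (linear (suc n) (ℕ.+-mono-≤ 13≤ (ℕ.+-mono-≤ n<d n<d)) (ℕ-Solver.solve (d ∷ n ∷ [])))
  ... | no n≮2c | _ = split-rest (balanced-split {n}
      (linear 0 (ℕ.+-mono-≤ 2c≤n (ℕ.+-mono-≤ 1≤c 1≤c)) (ℕ-Solver.solve (c ∷ n ∷ []))))
    where
    1≤c = Power-positive pc
    2c≤n : c + c ≤ n
    2c≤n = ℕ.≮⇒≥ n≮2c
    split-rest : ∃[ b ] ∃[ t ] b + t ≡ n × Power b × Balanced b t → join c n ≤ℚ f m
    split-rest (b , t , refl , pb , bal@(b≤2t , t<2b)) with Power-compare pc pb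
    -- A power of at most `c / 2` would leave `n = b + t < 3b < 2c`.
    ... | inj₂ 2b≤c = ⊥-elim (ℕ.n≮0
        (linear b (ℕ.+-mono-≤ t<2b (ℕ.+-mono-≤ 2c≤n (ℕ.+-mono-≤ 2b≤c 2b≤c))) (ℕ-Solver.solve (b ∷ c ∷ t ∷ []))))
    ... | inj₁ c≤b with Power-compare pb pc
    ... | inj₁ b≤c with refl ← ℕ.≤-antisym b≤c c≤b = merge pc (ℕ.+-cancelˡ-≤ c c t 2c≤n) t<2b e
    ... | inj₂ 2c≤b = begin
      join c (b + t)
        ≤⟨ rotate {t = t} 1≤c c≤b (upper pb bal 7≤b+t)
            (ih c t b 1≤c 1≤t (Power-positive pb) (via e (ℕ-Solver.solve (b ∷ c ∷ t ∷ [])))) ⟩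
      join b (c + t)
        ≤⟨ finish ⟩
      f m ∎
      where
      open ≤-Reasoning
      1≤t = positive-half (Power-positive pb) b≤2t
      e′ : b + (c + t) ≡ m
      e′ = via e (ℕ-Solver.solve (b ∷ c ∷ t ∷ []))
      13≤ : 13 ≤ c + (b + t)
      13≤ = subst (13 ≤_) (sym e) 13≤m
      7≤b+t : 7 ≤ b + t
      7≤b+t = halve-≤ (linear t (ℕ.+-mono-≤ 13≤ (ℕ.+-mono-≤ 2c≤b 1≤c)) (ℕ-Solver.solve (b ∷ c ∷ t ∷ [])))
      finish : join b (c + t) ≤ℚ f m
      finish with c + t ℕ.<? b + b
      ... | yes small = optimal b (c + t) pb
          (ℕ.≤-trans b≤2t (ℕ.+-mono-≤ (ℕ.m≤n+m t c) (ℕ.m≤n+m t c)) , small) e′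
      -- After the rotation the partner of `b` is too large for its window. It is rewritten as
      -- `b + u` with `b ≤ u < 2b`, and the two copies of `b` merge.
      ... | no big with u , r ← ℕ.m≤n⇒∃[o]m+o≡n (ℕ.≤-trans (ℕ.m≤m+n b b) (ℕ.≮⇒≥ big)) =
        subst (λ x → join b x ≤ℚ f m) r
          (merge pb (ℕ.+-cancelˡ-≤ b b u (subst (b + b ≤_) (sym r) (ℕ.≮⇒≥ big)))
            (linear c (ℕ.+-mono-≤ (ℕ.≤-reflexive r) (ℕ.+-mono-≤ t<2b 2c≤b))
                (ℕ-Solver.solve (b ∷ c ∷ t ∷ u ∷ [])))
            (trans (cong (b +_) r) e′))

  ih< : ∀ p q {n} → n ≡ m → 1 ≤ p → 1 ≤ q → p + q < n → join p q ≤ℚ f (p + q)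
  ih< p q refl 1≤p 1≤q p+q<n = ih′ 1≤p 1≤q p+q<n

  -- Here `d + d` is the prescribed power `c` of the larger part. All further pieces have size at
  -- least `d ≥ 4`, which secures `φ-gap` and keeps the opened sizes above 6.
  module Halved {d : ℕ} (pd : Power d) (4≤d : 4 ≤ d) where

    pc : Power (d + d)
    pc = Power-double pd

    1≤d : 1 ≤ d
    1≤d = Power-positive pd

    1≤c : 1 ≤ (d + d)
    1≤c = Power-positive pc

    2≤d : 2 ≤ d
    2≤d = ℕ.≤-trans (s≤s (s≤s z≤n)) 4≤d

    1≤-from : ∀ {t} → d ≤ t → 1 ≤ t
    1≤-from = ℕ.≤-trans 1≤d

    7≤-from : ∀ {x y} → d ≤ x → d ≤ y → 7 ≤ x + y
    7≤-from p q = ℕ.≤-trans (ℕ.n≤1+n 7) (ℕ.≤-trans (ℕ.+-mono-≤ 4≤d 4≤d) (ℕ.+-mono-≤ p q))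

    d≤c : d ≤ (d + d)
    d≤c = ℕ.m≤m+n d d

    upper-d : ∀ {t} → d ≤ t → t < (d + d) → f (d + t) ≤ℚ join d t
    upper-d {t} d≤t t<c = upper pd (ℕ.≤-trans d≤t (ℕ.m≤m+n t t) , t<c) (7≤-from ℕ.≤-refl d≤t)

    upper-c : ∀ {t} → d ≤ t → t < (d + d) + (d + d) → f ((d + d) + t) ≤ℚ join (d + d) t
    upper-c {t} d≤t t<2c = upper pc (ℕ.+-mono-≤ d≤t d≤t , t<2c) (7≤-from d≤c d≤t)

    <c⇒<2c : ∀ {t} → t < (d + d) → t < (d + d) + (d + d)
    <c⇒<2c t<c = ℕ.≤-trans t<c (ℕ.m≤m+n (d + d) (d + d))

    d+<2c : ∀ {t} → t < (d + d) → d + t < (d + d) + (d + d)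
    d+<2c {t} t<c = linear d t<c (ℕ-Solver.solve (d ∷ t ∷ []))

    -- The sum `r + t` lies between `2d` and `4d`; its prescribed power is `d` below `3d` and `c`
    -- from `3d` on, which selects the small or the large rotation.
    unequal : ∀ {r t} → d ≤ r → r < (d + d) → d ≤ t → t < (d + d) → (d + d) + r + ((d + d) + (d + t)) ≡ m →
              join ((d + d) + r) ((d + d) + (d + t)) ≤ℚ f m
    unequal {r} {t} d≤r r<c d≤t t<c e with r + t ℕ.<? (d + d) + d
    ... | yes small with x , r+t≡d+x ← ℕ.m≤n⇒∃[o]m+o≡n (ℕ.≤-trans d≤r (ℕ.m≤m+n r t)) = ≤-trans
      (pair-unequal-small d≤r (ℕ.<⇒≤ r<c) d≤t (sym r+t≡d+x)
        (upper-c d≤r (<c⇒<2c r<c)) (upper-c (ℕ.m≤m+n d t) (d+<2c t<c)) (upper-d d≤t t<c)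
        (ih r t ((d + d) + ((d + d) + d)) 1≤r 1≤t (ℕ.≤-trans 1≤c (ℕ.m≤m+n (d + d) ((d + d) + d)))
            (via e (ℕ-Solver.solve (d ∷ r ∷ t ∷ []))))
        (upper-d d≤x x<c)
        (ih (d + d) x ((d + d) + (d + d)) 1≤c (1≤-from d≤x) (ℕ.≤-trans 1≤c (ℕ.m≤m+n (d + d) (d + d)))
            (via total (ℕ-Solver.solve (d ∷ x ∷ [])))))
      (power-join (Power-double pc) (ℕ.≤-trans 1≤c (ℕ.m≤m+n (d + d) x))
          (via total (ℕ-Solver.solve (d ∷ x ∷ []))))
      where
      1≤r = 1≤-from d≤r
      1≤t = 1≤-from d≤t
      d≤x : d ≤ x
      d≤x = linear 0 (ℕ.+-mono-≤ d≤r (ℕ.+-mono-≤ d≤t (ℕ.≤-reflexive (sym r+t≡d+x))))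
          (ℕ-Solver.solve (d ∷ r ∷ t ∷ x ∷ []))
      x<c : x < (d + d)
      x<c = linear 0 (ℕ.+-mono-≤ small (ℕ.≤-reflexive r+t≡d+x)) (ℕ-Solver.solve (d ∷ r ∷ t ∷ x ∷ []))
      total : d + x + ((d + d) + ((d + d) + d)) ≡ m
      total = trans (cong (_+ ((d + d) + ((d + d) + d))) r+t≡d+x) (via e (ℕ-Solver.solve (d ∷ r ∷ t ∷ [])))
      hdd = ih d d (x + ((d + d) + (d + d))) 1≤d 1≤d (ℕ.≤-trans (1≤-from d≤x) (ℕ.m≤m+n x ((d + d) + (d + d))))
          (via total (ℕ-Solver.solve (d ∷ x ∷ [])))
      hcc = ih (d + d) (d + d) (d + (d + x)) 1≤c 1≤c (ℕ.≤-trans 1≤d (ℕ.m≤m+n d (d + x)))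
          (via total (ℕ-Solver.solve (d ∷ x ∷ [])))
      open Doubled 1≤d hdd hcc
    ... | no big with y , r+t≡c+y ← ℕ.m≤n⇒∃[o]m+o≡n (ℕ.≤-trans (ℕ.m≤m+n (d + d) d) (ℕ.≮⇒≥ big)) = ≤-trans
      (pair-unequal-large d≤r (ℕ.<⇒≤ r<c) d≤t (ℕ.<⇒≤ t<c) (1≤-from d≤y) (sym r+t≡c+y)
        (upper-c d≤r (<c⇒<2c r<c)) (upper-c (ℕ.m≤m+n d t) (d+<2c t<c)) (upper-d d≤t t<c)
        (ih r t ((d + d) + ((d + d) + d)) 1≤r 1≤t (ℕ.≤-trans 1≤c (ℕ.m≤m+n (d + d) ((d + d) + d)))
            (via e (ℕ-Solver.solve (d ∷ r ∷ t ∷ []))))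
        (upper-c d≤y (<c⇒<2c y<c))
        (ih d y ((d + d) + ((d + d) + (d + d))) 1≤d (1≤-from d≤y)
            (ℕ.≤-trans 1≤c (ℕ.m≤m+n (d + d) ((d + d) + (d + d)))) (via total (ℕ-Solver.solve (d ∷ y ∷ []))))
        (ih (d + d) (d + y) ((d + d) + (d + d)) 1≤c (ℕ.≤-trans 1≤d (ℕ.m≤m+n d y))
            (ℕ.≤-trans 1≤c (ℕ.m≤m+n (d + d) (d + d))) (via total (ℕ-Solver.solve (d ∷ y ∷ [])))))
      (power-join (Power-double pc) (ℕ.≤-trans 1≤c (ℕ.m≤m+n (d + d) (d + y)))
          (via total (ℕ-Solver.solve (d ∷ y ∷ []))))
      where
      1≤r = 1≤-from d≤r
      1≤t = 1≤-from d≤t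
      d≤y : d ≤ y
      d≤y = linear 0 (ℕ.+-mono-≤ (ℕ.≮⇒≥ big) (ℕ.≤-reflexive (sym r+t≡c+y)))
          (ℕ-Solver.solve (d ∷ r ∷ t ∷ y ∷ []))
      y<c : y < (d + d)
      y<c = linear 1 (ℕ.+-mono-≤ r<c (ℕ.+-mono-≤ t<c (ℕ.≤-reflexive r+t≡c+y)))
          (ℕ-Solver.solve (d ∷ r ∷ t ∷ y ∷ []))
      total : (d + d) + y + ((d + d) + ((d + d) + d)) ≡ m
      total = trans (cong (_+ ((d + d) + ((d + d) + d))) r+t≡c+y) (via e (ℕ-Solver.solve (d ∷ r ∷ t ∷ [])))
      hdd = ih d d (y + ((d + d) + ((d + d) + d))) 1≤d 1≤d
          (ℕ.≤-trans (1≤-from d≤y) (ℕ.m≤m+n y ((d + d) + ((d + d) + d))))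
          (via total (ℕ-Solver.solve (d ∷ y ∷ [])))
      hcc = ih (d + d) (d + d) (d + ((d + d) + y)) 1≤c 1≤c (ℕ.≤-trans 1≤d (ℕ.m≤m+n d ((d + d) + y)))
          (via total (ℕ-Solver.solve (d ∷ y ∷ [])))
      open Doubled 1≤d hdd hcc

    -- The left part has prescribed power `d`, the right one `c`. As in `unequal`, the threshold
    -- `3d` for `r + s` selects the rotation; in the small case a single `c` is split off at the
    -- root, in the large case `c + c`.
    crossed : ∀ {r s} → d < r → r < (d + d) → d ≤ s → s ≤ (d + d) → d + r + ((d + d) + s) ≡ m →
              join (d + r) ((d + d) + s) ≤ℚ f m
    crossed {r} {s} d<r r<c d≤s s≤c e with r + s ℕ.<? (d + d) + d
    ... | yes small with x , r+s≡d+x ← ℕ.m≤n⇒∃[o]m+o≡n (ℕ.≤-trans (ℕ.<⇒≤ d<r) (ℕ.m≤m+n r s)) = ≤-trans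
      (pair-crossed-small 2≤d d≤r d≤s s≤c (sym r+s≡d+x)
        (upper-d d≤r r<c) (upper-c d≤s s<2c)
        (ih r s ((d + d) + d) 1≤r 1≤s (ℕ.≤-trans 1≤c (ℕ.m≤m+n (d + d) d))
            (via e (ℕ-Solver.solve (d ∷ r ∷ s ∷ []))))
        (upper-d d≤x x<c)
        (ih (d + d) x (d + d) 1≤c (1≤-from d≤x) 1≤c (via total (ℕ-Solver.solve (d ∷ x ∷ [])))))
      (power-join pc (ℕ.≤-trans 1≤c (ℕ.m≤m+n (d + d) x)) (via total (ℕ-Solver.solve (d ∷ x ∷ []))))
      where
      d≤r = ℕ.<⇒≤ d<r
      1≤r = 1≤-from d≤r
      1≤s = 1≤-from d≤s
      s<2c : s < (d + d) + (d + d)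
      s<2c = ℕ.≤-trans (s≤s s≤c) (ℕ.+-monoˡ-≤ (d + d) 1≤c)
      d≤x : d ≤ x
      d≤x = linear 0 (ℕ.+-mono-≤ d≤r (ℕ.+-mono-≤ d≤s (ℕ.≤-reflexive (sym r+s≡d+x))))
          (ℕ-Solver.solve (d ∷ r ∷ s ∷ x ∷ []))
      4d<m : (d + d) + (d + d) < d + r + ((d + d) + s)
      4d<m = linear d (ℕ.+-mono-≤ d<r d≤s) (ℕ-Solver.solve (d ∷ r ∷ s ∷ []))
      x<c : x < (d + d)
      x<c = linear 0 (ℕ.+-mono-≤ small (ℕ.≤-reflexive r+s≡d+x)) (ℕ-Solver.solve (d ∷ r ∷ s ∷ x ∷ []))
      total : d + x + ((d + d) + d) ≡ m
      total = trans (cong (_+ ((d + d) + d)) r+s≡d+x) (via e (ℕ-Solver.solve (d ∷ r ∷ s ∷ [])))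
      hdd = ih d d (x + (d + d)) 1≤d 1≤d (ℕ.≤-trans (1≤-from d≤x) (ℕ.m≤m+n x (d + d)))
          (via total (ℕ-Solver.solve (d ∷ x ∷ [])))
      hcc = ih< (d + d) (d + d) e 1≤c 1≤c 4d<m
      open Doubled 1≤d hdd hcc
    ... | no big with y , r+s≡c+y ← ℕ.m≤n⇒∃[o]m+o≡n (ℕ.≤-trans (ℕ.m≤m+n (d + d) d) (ℕ.≮⇒≥ big)) = ≤-trans
      (pair-crossed-large 2≤d (ℕ.≤-trans 2≤d d≤y) d≤r (ℕ.<⇒≤ r<c) d≤s s≤c (sym r+s≡c+y)
        (upper-d d≤r r<c) (upper-c d≤s s<2c)
        (ih r s ((d + d) + d) 1≤r 1≤s (ℕ.≤-trans 1≤c (ℕ.m≤m+n (d + d) d))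
            (via e (ℕ-Solver.solve (d ∷ r ∷ s ∷ []))))
        (upper-c d≤y (<c⇒<2c y<c))
        (ih d y ((d + d) + (d + d)) 1≤d (1≤-from d≤y) (ℕ.≤-trans 1≤c (ℕ.m≤m+n (d + d) (d + d)))
            (via total (ℕ-Solver.solve (d ∷ y ∷ [])))))
      (power-join (Power-double pc) (ℕ.≤-trans 1≤d (ℕ.m≤m+n d y)) (via total (ℕ-Solver.solve (d ∷ y ∷ []))))
      where
      d≤r = ℕ.<⇒≤ d<r
      1≤r = 1≤-from d≤r
      1≤s = 1≤-from d≤s
      s<2c : s < (d + d) + (d + d)
      s<2c = ℕ.≤-trans (s≤s s≤c) (ℕ.+-monoˡ-≤ (d + d) 1≤c)
      d≤y : d ≤ y
      d≤y = linear 0 (ℕ.+-mono-≤ (ℕ.≮⇒≥ big) (ℕ.≤-reflexive (sym r+s≡c+y)))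
          (ℕ-Solver.solve (d ∷ r ∷ s ∷ y ∷ []))
      y<c : y < (d + d)
      y<c = linear 0 (ℕ.+-mono-≤ r<c (ℕ.+-mono-≤ s≤c (ℕ.≤-reflexive r+s≡c+y)))
          (ℕ-Solver.solve (d ∷ r ∷ s ∷ y ∷ []))
      total : (d + d) + y + ((d + d) + d) ≡ m
      total = trans (cong (_+ ((d + d) + d)) r+s≡c+y) (via e (ℕ-Solver.solve (d ∷ r ∷ s ∷ [])))
      hdd = ih d d (y + ((d + d) + d)) 1≤d 1≤d (ℕ.≤-trans (1≤-from d≤y) (ℕ.m≤m+n y ((d + d) + d)))
          (via total (ℕ-Solver.solve (d ∷ y ∷ [])))
      hcc = ih (d + d) (d + d) (d + y) 1≤c 1≤c (ℕ.≤-trans 1≤d (ℕ.m≤m+n d y))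
          (via total (ℕ-Solver.solve (d ∷ y ∷ [])))
      open Doubled 1≤d hdd hcc

    -- Both parts have prescribed power `c`. If `r` and `s` lie on the same side of `c`, pairing the
    -- two blocks `c` wins. If `r < c < s`, the product `(φ c - φ r)(φ c - φ s)` has the wrong sign,
    -- so `s` is opened too, at `d` below `3d` and at `c` from there on.
    large-left : ∀ {r s} → d ≤ r → r ≤ s → d ≤ s → s < (d + d) + (d + d) → (d + d) + r + ((d + d) + s) ≡ m →
                 join ((d + d) + r) ((d + d) + s) ≤ℚ f m
    large-left {r} {s} d≤r r≤s d≤s s<2c e with s ℕ.≤? (d + d)
    ... | yes s≤c = ≤-trans
      (pair-equal-below (ℕ.≤-trans 2≤d d≤r) (ℕ.≤-trans 2≤d d≤s) (ℕ.≤-trans r≤s s≤c) s≤c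
        (upper-c d≤r (ℕ.≤-trans (s≤s r≤s) s<2c)) (upper-c d≤s s<2c)
        (ih (d + d) (d + d) (r + s) 1≤c 1≤c (ℕ.≤-trans (1≤-from d≤r) (ℕ.m≤m+n r s))
            (via e (ℕ-Solver.solve (d ∷ r ∷ s ∷ []))))
        (ih r s ((d + d) + (d + d)) (1≤-from d≤r) (1≤-from d≤s) (ℕ.≤-trans 1≤c (ℕ.m≤m+n (d + d) (d + d)))
            (via e (ℕ-Solver.solve (d ∷ r ∷ s ∷ [])))))
      (power-join (Power-double pc) (ℕ.≤-trans (1≤-from d≤r) (ℕ.m≤m+n r s))
          (via e (ℕ-Solver.solve (d ∷ r ∷ s ∷ []))))
    ... | no s≰c with r ℕ.<? (d + d)
    ... | no r≮c = ≤-trans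
      (pair-equal-above (ℕ.≤-trans 2≤d d≤c) (ℕ.≮⇒≥ r≮c) (ℕ.<⇒≤ (ℕ.≰⇒> s≰c))
        (upper-c d≤r (ℕ.≤-trans (s≤s r≤s) s<2c)) (upper-c d≤s s<2c)
        (ih (d + d) (d + d) (r + s) 1≤c 1≤c (ℕ.≤-trans (1≤-from d≤r) (ℕ.m≤m+n r s))
            (via e (ℕ-Solver.solve (d ∷ r ∷ s ∷ []))))
        (ih r s ((d + d) + (d + d)) (1≤-from d≤r) (1≤-from d≤s) (ℕ.≤-trans 1≤c (ℕ.m≤m+n (d + d) (d + d)))
            (via e (ℕ-Solver.solve (d ∷ r ∷ s ∷ [])))))
      (power-join (Power-double pc) (ℕ.≤-trans (1≤-from d≤r) (ℕ.m≤m+n r s))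
          (via e (ℕ-Solver.solve (d ∷ r ∷ s ∷ []))))
    ... | yes r<c with s ℕ.<? (d + d) + d
    ... | yes s<3d with t , refl ← ℕ.m≤n⇒∃[o]m+o≡n d≤s =
      unequal d≤r r<c (ℕ.+-cancelˡ-≤ d d t (ℕ.<⇒≤ (ℕ.≰⇒> s≰c)))
          (ℕ.+-cancelˡ-< d t (d + d) (subst (d + t <_) (ℕ.+-comm (d + d) d) s<3d)) e
    ... | no s≮3d with t , refl ← ℕ.m≤n⇒∃[o]m+o≡n (ℕ.≤-trans (ℕ.m≤m+n (d + d) d) (ℕ.≮⇒≥ s≮3d)) = ≤-trans
      (pair-third (1≤-from d≤r) (1≤-from d≤t) (ℕ.<⇒≤ r<c) (ℕ.<⇒≤ t<c)
        (upper-c d≤r (<c⇒<2c r<c)) (upper-c d≤s s<2c) (upper-c d≤t (<c⇒<2c t<c))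
        (ih (d + d) (d + d) (r + ((d + d) + t)) 1≤c 1≤c (ℕ.≤-trans (1≤-from d≤r) (ℕ.m≤m+n r ((d + d) + t)))
            (via e (ℕ-Solver.solve (d ∷ r ∷ t ∷ []))))
        (ih (d + d) (r + t) ((d + d) + (d + d)) 1≤c 1≤r+t (ℕ.≤-trans 1≤c (ℕ.m≤m+n (d + d) (d + d)))
            (via e (ℕ-Solver.solve (d ∷ r ∷ t ∷ []))))
        (ih r t ((d + d) + ((d + d) + (d + d))) (1≤-from d≤r) (1≤-from d≤t)
            (ℕ.≤-trans 1≤c (ℕ.m≤m+n (d + d) ((d + d) + (d + d)))) (via e (ℕ-Solver.solve (d ∷ r ∷ t ∷ [])))))
      (power-join (Power-double pc) (ℕ.≤-trans 1≤c (ℕ.m≤m+n (d + d) (r + t)))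
          (via e (ℕ-Solver.solve (d ∷ r ∷ t ∷ []))))
      where
      d≤t : d ≤ t
      d≤t = ℕ.+-cancelˡ-≤ (d + d) d t (ℕ.≮⇒≥ s≮3d)
      t<c : t < (d + d)
      t<c = ℕ.+-cancelˡ-< (d + d) t (d + d) s<2c
      1≤r+t : 1 ≤ r + t
      1≤r+t = ℕ.≤-trans (1≤-from d≤r) (ℕ.m≤m+n r t)

    -- The left part has prescribed power `d`. For `s` above `c` the remainder `s` is opened as
    -- well, again with threshold `3d`.
    small-left : ∀ {r s} → d < r → r < (d + d) → d ≤ s → s < (d + d) + (d + d) → d + r + ((d + d) + s) ≡ m →
                 join (d + r) ((d + d) + s) ≤ℚ f m
    small-left {r} {s} d<r r<c d≤s s<2c e with s ℕ.≤? (d + d)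
    ... | yes s≤c = crossed d<r r<c d≤s s≤c e
    ... | no s≰c with s ℕ.<? (d + d) + d
    ... | yes s<3d with t , refl ← ℕ.m≤n⇒∃[o]m+o≡n d≤s = ≤-trans
      (pair-halves d≤r (ℕ.≤-trans (ℕ.<⇒≤ r<c) (ℕ.m≤m+n (d + d) d)) d≤t
        (upper-d d≤r r<c) (upper-c d≤s s<2c) (upper-d d≤t t<c)
        (ih r t ((d + d) + (d + d)) 1≤r (1≤-from d≤t) (ℕ.≤-trans 1≤c (ℕ.m≤m+n (d + d) (d + d)))
            (via e (ℕ-Solver.solve (d ∷ r ∷ t ∷ [])))))
      (power-join (Power-double pc) (ℕ.≤-trans 1≤r (ℕ.m≤m+n r t)) (via e (ℕ-Solver.solve (d ∷ r ∷ t ∷ []))))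
      where
      d≤r = ℕ.<⇒≤ d<r
      1≤r = 1≤-from d≤r
      d≤t : d ≤ t
      d≤t = ℕ.+-cancelˡ-≤ d d t (ℕ.<⇒≤ (ℕ.≰⇒> s≰c))
      t<c : t < (d + d)
      t<c = ℕ.+-cancelˡ-< d t (d + d) (subst (d + t <_) (ℕ.+-comm (d + d) d) s<3d)
      hdd = ih d d (r + ((d + d) + t)) 1≤d 1≤d (ℕ.≤-trans 1≤r (ℕ.m≤m+n r ((d + d) + t)))
          (via e (ℕ-Solver.solve (d ∷ r ∷ t ∷ [])))
      hcc = ih (d + d) (d + d) (r + t) 1≤c 1≤c (ℕ.≤-trans 1≤r (ℕ.m≤m+n r t))
          (via e (ℕ-Solver.solve (d ∷ r ∷ t ∷ [])))
      open Doubled 1≤d hdd hcc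
    -- With `s = c + t`, one block `c` of the right part is moved over to the left part `d + r`.
    -- Read from the other side this is the configuration of `unequal`, with `t` and `r` in the
    -- roles of `r` and `t`.
    ... | no s≮3d with t , refl ← ℕ.m≤n⇒∃[o]m+o≡n (ℕ.≤-trans (ℕ.m≤m+n (d + d) d) (ℕ.≮⇒≥ s≮3d)) = begin
      join (d + r) ((d + d) + ((d + d) + t))
        ≡⟨ cong (join (d + r)) (ℕ.+-comm (d + d) ((d + d) + t)) ⟩
      join (d + r) ((d + d) + t + (d + d))
        ≤⟨ rotate {d + r} {(d + d) + t} {(d + d)} (ℕ.≤-trans 1≤d (ℕ.m≤m+n d r)) p≤s
            (subst₂ _≤ℚ_ (cong f (ℕ.+-comm (d + d) ((d + d) + t))) (join-comm (d + d) ((d + d) + t))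
            (upper-c d≤s s<2c)) (ih (d + r) (d + d) ((d + d) + t) (ℕ.≤-trans 1≤d (ℕ.m≤m+n d r)) 1≤c
            (ℕ.≤-trans 1≤c (ℕ.m≤m+n (d + d) t)) (via e (ℕ-Solver.solve (d ∷ r ∷ t ∷ [])))) ⟩
      join ((d + d) + t) (d + r + (d + d))
        ≡⟨ cong (join ((d + d) + t)) (ℕ.+-comm (d + r) (d + d)) ⟩
      join ((d + d) + t) ((d + d) + (d + r))
        ≤⟨ unequal d≤t t<c (ℕ.<⇒≤ d<r) r<c (via e (ℕ-Solver.solve (d ∷ r ∷ t ∷ []))) ⟩
      f m ∎
      where
      open ≤-Reasoning
      d≤t : d ≤ t
      d≤t = ℕ.+-cancelˡ-≤ (d + d) d t (ℕ.≮⇒≥ s≮3d)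
      t<c : t < (d + d)
      t<c = ℕ.+-cancelˡ-< (d + d) t (d + d) s<2c
      p≤s : d + r ≤ (d + d) + t
      p≤s = linear 1 (ℕ.+-mono-≤ r<c d≤t) (ℕ-Solver.solve (d ∷ r ∷ t ∷ []))

  -- A part `p ≤ c` can be rotated below the power `c` of `q`. Otherwise `c < p ≤ q < 3c`, so the
  -- prescribed power of `p` is `c / 2` or `c`, and the two possibilities are separated by `3c/2`.
  join≤ : ∀ {p q} → 1 ≤ p → p ≤ q → 12 ≤ q → p + q ≡ m → join p q ≤ℚ f m
  join≤ {p} {q} 1≤p p≤q 12≤q e = split-right (balanced-split (ℕ.≤-trans (ℕ.m≤m+n 2 10) 12≤q))
    where
    split-right : ∃[ c ] ∃[ s ] c + s ≡ q × Power c × Balanced c s → join p q ≤ℚ f m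
    split-right (c , s , refl , pc , bal@(c≤2s , s<2c)) with p ℕ.≤? c
    ... | yes p≤c = ≤-trans
      (rotate 1≤p p≤c (upper pc bal (ℕ.≤-trans (ℕ.m≤m+n 7 5) 12≤q))
        (ih p s c 1≤p (positive-half (Power-positive pc) c≤2s) (Power-positive pc)
            (via e (ℕ-Solver.solve (p ∷ c ∷ s ∷ [])))))
      (power-join pc (ℕ.≤-trans 1≤p (ℕ.m≤m+n p s)) (via e (ℕ-Solver.solve (p ∷ c ∷ s ∷ []))))
    ... | no p≰c = split-left (Power-halve pc (ℕ.≤-trans (s≤s (s≤s z≤n)) 5≤c))
      where
      -- From `12 ≤ q < 3c`. As `c` is a power of two it is then at least 8, whence `4 ≤ d`.
      5≤c : 5 ≤ c
      5≤c = ℕ.≮⇒≥ λ { (s≤s c≤4) → absurd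
          (linear 0 (ℕ.+-mono-≤ 12≤q (ℕ.+-mono-≤ s<2c (ℕ.+-mono-≤ c≤4 (ℕ.+-mono-≤ c≤4 c≤4))))
          (ℕ-Solver.solve (c ∷ s ∷ []))) (z≤n {0}) }
      split-left : ∃[ d ] Power d × d + d ≡ c → join p (c + s) ≤ℚ f m
      split-left (d , pd , refl) = cases (p ℕ.<? d + d + d)
        where
        4≤d : 4 ≤ d
        4≤d with Power-compare pd (1 , refl)
        ... | inj₂ 4≤d = 4≤d
        ... | inj₁ d≤2 = absurd 5≤c (ℕ.+-mono-≤ d≤2 d≤2)
        d≤s : d ≤ s
        d≤s = halve-≤ c≤2s
        open Halved pd 4≤d
        cases : Dec (p < d + d + d) → join p (d + d + s) ≤ℚ f m
        cases (yes p<3d) with r , refl ← ℕ.m≤n⇒∃[o]m+o≡n (ℕ.≤-trans (ℕ.m≤m+n d d) (ℕ.<⇒≤ (ℕ.≰⇒> p≰c))) =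
          small-left (ℕ.+-cancelˡ-< d d r (ℕ.≰⇒> p≰c))
              (ℕ.+-cancelˡ-< d r (d + d) (subst (d + r <_) (ℕ.+-comm (d + d) d) p<3d)) d≤s s<2c e
        cases (no p≮3d) with r , refl ← ℕ.m≤n⇒∃[o]m+o≡n (ℕ.≤-trans (ℕ.m≤m+n (d + d) d) (ℕ.≮⇒≥ p≮3d)) =
          large-left (ℕ.+-cancelˡ-≤ (d + d) d r (ℕ.≮⇒≥ p≮3d)) (ℕ.+-cancelˡ-≤ (d + d) r s p≤q) d≤s s<2c e

JoinSuperadditive : ℕ → Set
JoinSuperadditive m = ∀ {p q} → 1 ≤ p → 1 ≤ q → p + q ≡ m → join p q ≤ℚ f m

join-superadditive : ∀ m → JoinSuperadditive m
join-superadditive = <-rec JoinSuperadditive λ m rec → ordered (λ 1≤p 1≤q p+q<m → rec p+q<m 1≤p 1≤q refl)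
  where
  small : ∀ {p q} → 1 ≤ p → p ≤ 11 → 1 ≤ q → q ≤ 11 → join p q ≤ℚ f (p + q)
  small {suc p} {suc q} _ p≤11 _ q≤11 =
    subst (_≤ℚ f (suc p + suc q)) (node-scaled (suc p) (suc q) (H (suc p)) (H (suc q)))
      (*ε-mono (suc p + suc q) (ι-mono (node-superadditive-small p≤11 q≤11)))
  increasing : ∀ {m} → (∀ {p q} → 1 ≤ p → 1 ≤ q → p + q < m → join p q ≤ℚ f (p + q)) →
               ∀ {p q} → 1 ≤ p → p ≤ q → p + q ≡ m → join p q ≤ℚ f m
  increasing ih {p} {q} 1≤p p≤q refl with q ℕ.≤? 11
  ... | yes q≤11 = small 1≤p (ℕ.≤-trans p≤q q≤11) (ℕ.≤-trans 1≤p p≤q) q≤11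
  ... | no q≰11 = Step.join≤ (ℕ.+-mono-≤ 1≤p (ℕ.≰⇒> q≰11)) ih 1≤p p≤q (ℕ.≰⇒> q≰11) refl
  ordered : ∀ {m} → (∀ {p q} → 1 ≤ p → 1 ≤ q → p + q < m → join p q ≤ℚ f (p + q)) →
            JoinSuperadditive m
  ordered {m} ih {p} {q} 1≤p 1≤q e with ℕ.≤-total p q
  ... | inj₁ p≤q = increasing ih 1≤p p≤q e
  ... | inj₂ q≤p = subst (_≤ℚ f m) (join-comm q p) (increasing ih 1≤q q≤p (trans (ℕ.+-comm q p) e))

-- Optimality of `H` among split trees

ι-cancel-≤ : ∀ {a b} → ι a ≤ℚ ι b → a ≤ b
ι-cancel-≤ {a} {b} p = ℕ.≮⇒≥ λ b<a → 1≰0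
    (subst₂ _≤ℚ_ (cancel 1ℚ (ι b)) (+-inverseʳ (ι b)) (+-monoˡ-≤ (- ι b) (≤-trans (ι-mono b<a) p)))
  where
  1≰0 : ¬ 1ℚ ≤ℚ 0ℚ
  1≰0 = from-no (1ℚ ≤? 0ℚ)
  cancel : ∀ x y → x +ℚ y - y ≡ x
  cancel = solve-∀ ring

node-superadditive : ∀ {p q} → 1 ≤ p → 1 ≤ q → node p q (H p) (H q) ≤ H (p + q)
node-superadditive {p} {q} 1≤p 1≤q = ι-cancel-≤ (subst₂ _≤ℚ_ (unscale _) (unscale _)
  (*-monoʳ-≤-nonNeg (ι (2 ^ (p + q))) ⦃ nonNegative (ι-nonneg (2 ^ (p + q))) ⦄
    (subst (_≤ℚ f (p + q)) (sym (node-scaled p q (H p) (H q))) (join-superadditive (p + q) 1≤p 1≤q refl))))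
  where
  unscale : ∀ x → x *ℚ ε (p + q) *ℚ ι (2 ^ (p + q)) ≡ x
  unscale x = trans (*-assoc x (ε (p + q)) _)
      (trans (cong (x *ℚ_) (trans (*-comm (ε (p + q)) _) (ι*ε (p + q)))) (*-identityʳ x))

node-mono : ∀ p q {a b a′ b′} → a ≤ a′ → b ≤ b′ → node p q a b ≤ node p q a′ b′
node-mono p q a≤ b≤ = ℕ.+-monoˡ-≤ (p * q) (ℕ.+-mono-≤ (ℕ.*-monoʳ-≤ (2 ^ q) a≤) (ℕ.*-monoʳ-≤ (2 ^ p) b≤))

-- The second index is the weight of a split tree. Trees end in single vertices: the empty
-- multigraph on two vertices is `branch leaf leaf`, of weight `node 1 1 0 0 = 1`, its one pair of
-- multiplicity 0 counting `2 ^ 0`.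
data Achievable : ℕ → ℕ → Set where
  leaf   : Achievable 1 0
  branch : ∀ {p q a b} → Achievable p a → Achievable q b → Achievable (p + q) (node p q a b)

Achievable-positive : ∀ {n w} → Achievable n w → 1 ≤ n
Achievable-positive leaf = s≤s z≤n
Achievable-positive (branch {q = q} s t) = ℕ.≤-trans (Achievable-positive s) (ℕ.m≤m+n _ q)

Achievable-≤H : ∀ {n w} → Achievable n w → w ≤ H n
Achievable-≤H leaf = z≤n
Achievable-≤H (branch {p} {q} s t) = ℕ.≤-trans (node-mono p q (Achievable-≤H s) (Achievable-≤H t))
  (node-superadditive (Achievable-positive s) (Achievable-positive t))

H-achievable : ∀ n → 1 ≤ n → Achievable n (H n)
H-achievable = <-rec _ step
  where
  -- Two of these form the tree of weight 73 that the recursion misses at size 6.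
  triple : Achievable 3 4
  triple = branch (branch leaf leaf) leaf
  step : ∀ n → (∀ {k} → k < n → 1 ≤ k → Achievable k (H k)) → 1 ≤ n → Achievable n (H n)
  step (suc zero) rec _ = leaf
  step n@(suc (suc i)) rec _ with n ℕ.≟ 6
  ... | yes refl = branch triple triple
  ... | no n≢6 with c , s , e , (k , refl) , bal ← balanced-split {n} (s≤s (s≤s z≤n)) =
    subst (λ n → Achievable n (H n)) e
        (subst (Achievable (2 ^ k + s)) (sym (H-node k s bal (λ r → n≢6 (trans (sym e) r))))
      (branch (rec (subst (2 ^ k <_) e (ℕ.m<m+n (2 ^ k) 1≤s)) 1≤c) (rec (subst (s <_) e (ℕ.m<n+m s 1≤c)) 1≤s)))
    where
    1≤c = ℕ.m^n>0 2 k
    1≤s = positive-half 1≤c (proj₁ bal)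

-- The recurrence for h₂

hval≡ : ∀ m h → .⦃ _ : ℕ.NonZero m ⦄ → hval m h ≡ ι h *ℚ (inv m *ℚ ε (m ∸ 1))
hval≡ m h ⦃ m≢0 ⦄ = trans (divℕ≡ι*inv h (m * 2 ^ (m ∸ 1)))
  (cong (ι h *ℚ_) (inv-* m (2 ^ (m ∸ 1)) ⦃ m≢0 ⦄ ⦃ ℕ.m^n≢0 2 (m ∸ 1) ⦄))

-- Since `n * hval n h` is `2 h / 2 ^ n`, this is the additivity of the scaled weight, doubled and
-- divided by `p + q`.
hval-node : ∀ p q a b → .⦃ ℕ.NonZero p ⦄ → .⦃ ℕ.NonZero q ⦄ →
  hval (p + q) (node p q a b) ≡
  divℕ p (p + q) *ℚ hval p a +ℚ divℕ q (p + q) *ℚ hval q b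
  +ℚ divℕ (p * q) ((p + q) * 2 ^ (p + q ∸ 1))
hval-node p@(suc p′) q@(suc q′) a b = begin
  hval m (node p q a b)
    ≡⟨ hval≡ m (node p q a b) ⟩
  ι (node p q a b) *ℚ (inv m *ℚ e)
    ≡⟨ cong (_*ℚ (inv m *ℚ e)) (ι-node p q a b) ⟩
  (Q *ℚ ι a +ℚ P *ℚ ι b +ℚ ι p *ℚ ι q) *ℚ (inv m *ℚ e)
    ≡⟨ distribute Q (ι a) P (ι b) (ι p) (ι q) (inv m) e ⟩
  ι a *ℚ inv m *ℚ (Q *ℚ e) +ℚ ι b *ℚ inv m *ℚ (P *ℚ e) +ℚ ι p *ℚ ι q *ℚ (inv m *ℚ e)
    ≡⟨ cong₂ (λ x y → ι a *ℚ inv m *ℚ x +ℚ ι b *ℚ inv m *ℚ y +ℚ ι p *ℚ ι q *ℚ (inv m *ℚ e)) Qe Pe ⟩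
  ι a *ℚ inv m *ℚ ε p′ +ℚ ι b *ℚ inv m *ℚ ε q′ +ℚ ι p *ℚ ι q *ℚ (inv m *ℚ e)
    ≡⟨ cong₂ _+ℚ_ (cong₂ _+ℚ_ (factor p a) (factor q b)) last ⟨
  divℕ p m *ℚ hval p a +ℚ divℕ q m *ℚ hval q b +ℚ divℕ (p * q) (m * 2 ^ (m ∸ 1)) ∎
  where
  open ≡-Reasoning
  m : ℕ
  m = p + q
  e P Q : ℚ
  e = ε (m ∸ 1)
  P = ι (2 ^ p)
  Q = ι (2 ^ q)
  distribute : ∀ Q a P b p q i e → (Q *ℚ a +ℚ P *ℚ b +ℚ p *ℚ q) *ℚ (i *ℚ e) ≡ a *ℚ i *ℚ (Q *ℚ e) +ℚ b *ℚ i *ℚ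
      (P *ℚ e) +ℚ p *ℚ q *ℚ (i *ℚ e)
  distribute = solve-∀ ring
  Qe : Q *ℚ e ≡ ε p′
  Qe = sym (ε-rescale p′ q)
  Pe : P *ℚ e ≡ ε q′
  Pe = trans (cong (λ n → ι (2 ^ p) *ℚ ε n) (trans (ℕ.+-suc p′ q′) (ℕ.+-comm p q′))) (sym (ε-rescale q′ p))
  factor : ∀ n h → .⦃ _ : ℕ.NonZero n ⦄ → divℕ n m *ℚ hval n h ≡ ι h *ℚ inv m *ℚ ε (n ∸ 1)
  factor n h = begin
    divℕ n m *ℚ hval n h                           ≡⟨ cong₂ _*ℚ_ (divℕ≡ι*inv n m) (hval≡ n h) ⟩
    ι n *ℚ inv m *ℚ (ι h *ℚ (inv n *ℚ ε (n ∸ 1)))  ≡⟨ regroup (ι n) (inv m) (ι h) (inv n) (ε (n ∸ 1)) ⟩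
    (ι n *ℚ inv n) *ℚ (ι h *ℚ inv m *ℚ ε (n ∸ 1))  ≡⟨ cong (_*ℚ (ι h *ℚ inv m *ℚ ε (n ∸ 1))) (ι*inv n) ⟩
    1ℚ *ℚ (ι h *ℚ inv m *ℚ ε (n ∸ 1))              ≡⟨ *-identityˡ _ ⟩
    ι h *ℚ inv m *ℚ ε (n ∸ 1)                      ∎
    where
    regroup : ∀ n i h j e → n *ℚ i *ℚ (h *ℚ (j *ℚ e)) ≡ (n *ℚ j) *ℚ (h *ℚ i *ℚ e)
    regroup = solve-∀ ring
  last : divℕ (p * q) (m * 2 ^ (m ∸ 1)) ≡ ι p *ℚ ι q *ℚ (inv m *ℚ e)
  last = trans (hval≡ m (p * q)) (cong (_*ℚ (inv m *ℚ e)) (ι-* p q))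

three-halves : ∀ {k q} → 3 * 2 ^ k ≤ 2 * (2 ^ k + q) → 2 ^ k + q < 2 ^ k + 2 ^ (k + 1) → Balanced (2 ^ k) q
three-halves {k} {q} 3p≤2m m<3p = lower (2 ^ k) 3p≤2m , ℕ.+-cancelˡ-< (2 ^ k) q _
  (subst (λ r → 2 ^ k + q < 2 ^ k + r) (trans (cong (2 ^_) (ℕ.+-comm k 1)) (2^suc k)) m<3p)
  where
  lower : ∀ p → 3 * p ≤ 2 * (p + q) → p ≤ q + q
  lower p h = linear 0 h (ℕ-Solver.solve (p ∷ q ∷ []))

2p≤2m : ∀ p {m} → 3 * p ≤ 2 * m → p + p ≤ m + m
2p≤2m p {m} h = linear p h (ℕ-Solver.solve (p ∷ m ∷ []))

-- From 2-recursive multigraphs to split trees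

open import Algebra.Properties.Semiring.Sum ℕ.+-*-semiring using (sum; sum-cong-≗; ∑-distrib-+; *-distribˡ-sum)
open import Data.Fin using (Fin; toℕ; zero; suc)
open import Data.Fin.Subset using (Subset; ∣_∣; _∪_; _∩_; ⊥; ⊤; Nonempty; inside; outside)
open import Data.Fin.Subset.Properties using (∣⊤∣≡n)
open import Data.List using (List; map; concatMap; tabulate; allFin)
import Data.Nat.ListAction as List
open import Data.Nat.ListAction.Properties using (sum-++)
open import Data.Vec as Vec using ([]; _∷_; lookup; here; there)
import Data.Vec.Properties as Vec
open import Function using (_∘_; id)

∑∑ : ∀ {m n} → (Fin m → Fin n → ℕ) → ℕ
∑∑ F = sum (λ x → sum (F x))

∑∑-cong : ∀ {m n} {F G : Fin m → Fin n → ℕ} → (∀ x y → F x y ≡ G x y) → ∑∑ F ≡ ∑∑ G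
∑∑-cong F≡G = sum-cong-≗ (λ x → sum-cong-≗ (F≡G x))

∑∑-+ : ∀ {m n} (F G : Fin m → Fin n → ℕ) → ∑∑ (λ x y → F x y + G x y) ≡ ∑∑ F + ∑∑ G
∑∑-+ F G = trans (sum-cong-≗ (λ x → ∑-distrib-+ (F x) (G x))) (∑-distrib-+ (λ x → sum (F x)) (λ x → sum (G x)))

∑∑-* : ∀ {m n} c (F : Fin m → Fin n → ℕ) → ∑∑ (λ x y → c * F x y) ≡ c * ∑∑ F
∑∑-* c F = trans (sum-cong-≗ (λ x → sym (*-distribˡ-sum c (F x)))) (sym (*-distribˡ-sum c (λ x → sum (F x))))

sum-map-tabulate : ∀ {n} {A : Set} (g : A → ℕ) (h : Fin n → A) → List.sum (map g (tabulate h)) ≡ sum (g ∘ h)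
sum-map-tabulate {zero}  g h = refl
sum-map-tabulate {suc n} g h = cong (g (h zero) +_) (sum-map-tabulate g (h ∘ suc))

sum-concatMap-tabulate : ∀ {n} {A : Set} (g : A → List ℕ) (h : Fin n → A) →
                         List.sum (concatMap g (tabulate h)) ≡ sum (List.sum ∘ g ∘ h)
sum-concatMap-tabulate {zero}  g h = refl
sum-concatMap-tabulate {suc n} g h = trans (sum-++ (g (h zero)) _)
    (cong (List.sum (g (h zero)) +_) (sum-concatMap-tabulate g (h ∘ suc)))

⟦_⟧ : Bool → ℕ
⟦ b ⟧ = if b then 1 else 0

lt : ∀ {m} → Fin m → Fin m → ℕ
lt x y = ⟦ toℕ x <ᵇ toℕ y ⟧

χ : ∀ {m} → Subset m → Fin m → ℕ
χ V x = ⟦ lookup V x ⟧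

-- `weight2` restricted to pairs inside `V`, as the recursion on `Rec2` passes to subsets.
-- Conditions are factors 0 or 1, so that sums can be split by distributivity.
weight : ∀ {m} → Subset m → Mult m → ℕ
weight V M = ∑∑ (λ x y → lt x y * (χ V x * χ V y * 2 ^ M x y))

weight2≡weight-⊤ : ∀ {m} (M : Mult m) → weight2 M ≡ weight ⊤ M
weight2≡weight-⊤ {m} M = trans (sum-concatMap-tabulate (λ x → map (summand x) (allFin m)) id)
  (sum-cong-≗ λ x → trans (sum-map-tabulate (summand x) id) (sum-cong-≗ (entry x)))
  where
  summand : Fin m → Fin m → ℕ
  summand x y = if toℕ x <ᵇ toℕ y then 2 ^ M x y else 0
  entry : ∀ x y → summand x y ≡ lt x y * (χ ⊤ x * χ ⊤ y * 2 ^ M x y)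
  entry x y rewrite Vec.lookup-replicate x inside | Vec.lookup-replicate y inside with toℕ x <ᵇ toℕ y
  ... | true  = sym (trans (ℕ.*-identityˡ (1 * 2 ^ M x y)) (ℕ.*-identityˡ (2 ^ M x y)))
  ... | false = refl

∣∣≡sum-χ : ∀ {m} (V : Subset m) → ∣ V ∣ ≡ sum (χ V)
∣∣≡sum-χ []            = refl
∣∣≡sum-χ (inside  ∷ V) = cong suc (∣∣≡sum-χ V)
∣∣≡sum-χ (outside ∷ V) = ∣∣≡sum-χ V

zero-weight : ∀ {m} (V : Subset m) (M : Mult m) → (∀ x y → M x y ≡ 0) →
              weight V M ≡ ∑∑ (λ x y → lt x y * (χ V x * χ V y))
zero-weight V M M≡0 = ∑∑-cong λ x y → cong (lt x y *_)
    (trans (cong (λ k → χ V x * χ V y * 2 ^ k) (M≡0 x y)) (ℕ.*-identityʳ _))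

pairs-∷ : ∀ {m} b (V : Subset m) → ∑∑ (λ x y → lt x y * (χ (b ∷ V) x * χ (b ∷ V) y))
                                 ≡ ⟦ b ⟧ * ∣ V ∣ + ∑∑ (λ x y → lt x y * (χ V x * χ V y))
pairs-∷ b V = cong (_+ ∑∑ (λ x y → lt x y * (χ V x * χ V y))) (begin
  sum (λ y → 1 * (⟦ b ⟧ * χ V y))  ≡⟨ sum-cong-≗ (λ y → ℕ.*-identityˡ (⟦ b ⟧ * χ V y)) ⟩
  sum (λ y → ⟦ b ⟧ * χ V y)        ≡⟨ *-distribˡ-sum ⟦ b ⟧ (χ V) ⟨
  ⟦ b ⟧ * sum (χ V)                ≡⟨ cong (⟦ b ⟧ *_) (∣∣≡sum-χ V) ⟨
  ⟦ b ⟧ * ∣ V ∣                    ∎)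
  where open ≡-Reasoning

pairs-0 : ∀ {m} (V : Subset m) → ∣ V ∣ ≡ 0 → ∑∑ (λ x y → lt x y * (χ V x * χ V y)) ≡ 0
pairs-0 []            _ = refl
pairs-0 (outside ∷ V) e = trans (pairs-∷ outside V) (pairs-0 V e)

pairs-1 : ∀ {m} (V : Subset m) → ∣ V ∣ ≡ 1 → ∑∑ (λ x y → lt x y * (χ V x * χ V y)) ≡ 0
pairs-1 (outside ∷ V) e = trans (pairs-∷ outside V) (pairs-1 V e)
pairs-1 (inside  ∷ V) e = trans (pairs-∷ inside V)
    (cong₂ _+_ (trans (ℕ.*-identityˡ ∣ V ∣) (ℕ.suc-injective e)) (pairs-0 V (ℕ.suc-injective e)))

pairs-2 : ∀ {m} (V : Subset m) → ∣ V ∣ ≡ 2 → ∑∑ (λ x y → lt x y * (χ V x * χ V y)) ≡ 1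
pairs-2 (outside ∷ V) e = trans (pairs-∷ outside V) (pairs-2 V e)
pairs-2 (inside  ∷ V) e = trans (pairs-∷ inside V)
    (cong₂ _+_ (trans (ℕ.*-identityˡ ∣ V ∣) (ℕ.suc-injective e)) (pairs-1 V (ℕ.suc-injective e)))

-- By induction on the first vertex: it lies in at most one of the two sets and forms a crossing
-- pair with every vertex of the other.
crossing : ∀ {m} (V₁ V₂ : Subset m) → V₁ ∩ V₂ ≡ ⊥ →
           ∑∑ (λ x y → lt x y * (χ V₁ x * χ V₂ y + χ V₂ x * χ V₁ y)) ≡ ∣ V₁ ∣ * ∣ V₂ ∣
crossing []       []       _ = refl
crossing (a ∷ V₁) (b ∷ V₂) e = begin
  sum (λ y → 1 * (⟦ a ⟧ * χ V₂ y + ⟦ b ⟧ * χ V₁ y)) + ∑∑ (λ x y → lt x y * (χ V₁ x * χ V₂ y + χ V₂ x * χ V₁ y))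
    ≡⟨ cong₂ _+_ (first ⟦ a ⟧ ⟦ b ⟧) (crossing V₁ V₂ (Vec.∷-injectiveʳ e)) ⟩
  ⟦ a ⟧ * ∣ V₂ ∣ + ⟦ b ⟧ * ∣ V₁ ∣ + ∣ V₁ ∣ * ∣ V₂ ∣
    ≡⟨ heads a b (Vec.∷-injectiveˡ e) ⟩
  ∣ a ∷ V₁ ∣ * ∣ b ∷ V₂ ∣ ∎
  where
  open ≡-Reasoning
  first : ∀ i j → sum (λ y → 1 * (i * χ V₂ y + j * χ V₁ y)) ≡ i * ∣ V₂ ∣ + j * ∣ V₁ ∣
  first i j = begin
    sum (λ y → 1 * (i * χ V₂ y + j * χ V₁ y))
      ≡⟨ sum-cong-≗ (λ y → ℕ.*-identityˡ (i * χ V₂ y + j * χ V₁ y)) ⟩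
    sum (λ y → i * χ V₂ y + j * χ V₁ y)
      ≡⟨ ∑-distrib-+ (λ y → i * χ V₂ y) (λ y → j * χ V₁ y) ⟩
    sum (λ y → i * χ V₂ y) + sum (λ y → j * χ V₁ y)
      ≡⟨ cong₂ _+_ (*-distribˡ-sum i (χ V₂)) (*-distribˡ-sum j (χ V₁)) ⟨
    i * sum (χ V₂) + j * sum (χ V₁)
      ≡⟨ cong₂ (λ u v → i * u + j * v) (∣∣≡sum-χ V₂) (∣∣≡sum-χ V₁) ⟨
    i * ∣ V₂ ∣ + j * ∣ V₁ ∣ ∎
  heads : ∀ a b → a ∧ b ≡ false → ⟦ a ⟧ * ∣ V₂ ∣ + ⟦ b ⟧ * ∣ V₁ ∣ + ∣ V₁ ∣ * ∣ V₂ ∣ ≡ ∣ a ∷ V₁ ∣ * ∣ b ∷ V₂ ∣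
  heads false false _ = refl
  heads true  false _ = cong (_+ ∣ V₁ ∣ * ∣ V₂ ∣) (trans (ℕ.+-identityʳ _) (ℕ.*-identityˡ ∣ V₂ ∣))
  heads false true  _ = trans (cong (_+ ∣ V₁ ∣ * ∣ V₂ ∣) (ℕ.*-identityˡ ∣ V₁ ∣)) (sym (ℕ.*-suc ∣ V₁ ∣ ∣ V₂ ∣))

∣∪∣-disjoint : ∀ {m} (V₁ V₂ : Subset m) → V₁ ∩ V₂ ≡ ⊥ → ∣ V₁ ∪ V₂ ∣ ≡ ∣ V₁ ∣ + ∣ V₂ ∣
∣∪∣-disjoint []            []            _ = refl
∣∪∣-disjoint (outside ∷ V) (outside ∷ W) e = ∣∪∣-disjoint V W (Vec.∷-injectiveʳ e)
∣∪∣-disjoint (inside  ∷ V) (outside ∷ W) e = cong suc (∣∪∣-disjoint V W (Vec.∷-injectiveʳ e))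
∣∪∣-disjoint (outside ∷ V) (inside  ∷ W) e = trans (cong suc (∣∪∣-disjoint V W (Vec.∷-injectiveʳ e)))
    (sym (ℕ.+-suc ∣ V ∣ ∣ W ∣))

-- Multiplicities are defined on all vertices, so in a split `M₁` must vanish off `V₁` in order not
-- to disturb pairs within `V₂` or between the two sets.
Supported : ∀ {m} → Subset m → Mult m → Set
Supported V M = ∀ x y → lookup V x ∧ lookup V y ≡ false → M x y ≡ 0

-- A pair inside one part gains as many copies as the other part has vertices, which multiplies its
-- weight by a power of two. A crossing pair has multiplicity 0 and contributes 1, whence the
-- summand `p * q` of `node`.
weight-split : ∀ {m} (V₁ V₂ : Subset m) (M₁ M₂ M : Mult m) → V₁ ∩ V₂ ≡ ⊥ → Supported V₁ M₁ → Supported V₂ M₂ →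
               (∀ x y → M x y ≡ M₁ x y + M₂ x y + cross V₁ V₂ x y) →
               weight (V₁ ∪ V₂) M ≡ node ∣ V₁ ∣ ∣ V₂ ∣ (weight V₁ M₁) (weight V₂ M₂)
weight-split V₁ V₂ M₁ M₂ M disjoint supp₁ supp₂ M≡ = begin
  weight (V₁ ∪ V₂) M
    ≡⟨ ∑∑-cong entry ⟩
  ∑∑ (λ x y → 2 ^ ∣ V₂ ∣ * F₁ x y + 2 ^ ∣ V₁ ∣ * F₂ x y + G x y)
    ≡⟨ trans (∑∑-+ (λ x y → 2 ^ ∣ V₂ ∣ * F₁ x y + 2 ^ ∣ V₁ ∣ * F₂ x y) G)
        (cong (_+ ∑∑ G) (∑∑-+ (λ x y → 2 ^ ∣ V₂ ∣ * F₁ x y) (λ x y → 2 ^ ∣ V₁ ∣ * F₂ x y))) ⟩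
  ∑∑ (λ x y → 2 ^ ∣ V₂ ∣ * F₁ x y) + ∑∑ (λ x y → 2 ^ ∣ V₁ ∣ * F₂ x y) + ∑∑ G
    ≡⟨ cong₂ _+_ (cong₂ _+_ (∑∑-* (2 ^ ∣ V₂ ∣) F₁) (∑∑-* (2 ^ ∣ V₁ ∣) F₂)) (crossing V₁ V₂ disjoint) ⟩
  node ∣ V₁ ∣ ∣ V₂ ∣ (weight V₁ M₁) (weight V₂ M₂) ∎
  where
  open ≡-Reasoning
  F₁ F₂ G : Fin _ → Fin _ → ℕ
  F₁ x y = lt x y * (χ V₁ x * χ V₁ y * 2 ^ M₁ x y)
  F₂ x y = lt x y * (χ V₂ x * χ V₂ y * 2 ^ M₂ x y)
  G x y = lt x y * (χ V₁ x * χ V₂ y + χ V₂ x * χ V₁ y)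
  disjoint-at : ∀ x → lookup V₁ x ∧ lookup V₂ x ≡ false
  disjoint-at x = trans (sym (Vec.lookup-zipWith _∧_ x V₁ V₂))
      (trans (cong (λ V → lookup V x) disjoint) (Vec.lookup-replicate x outside))
  zeros : ∀ P Q → 0 ≡ P * 0 + Q * 0 + 0
  zeros = ℕ-Solver.solve-∀
  outer : ∀ P Q → 1 ≡ P * 0 + Q * 0 + 1
  outer = ℕ-Solver.solve-∀
  -- a and b tell whether x lies in V₁, V₂ and a′, b′ do so for y
  table : ∀ a b a′ b′ m₁ m₂ → a ∧ b ≡ false → a′ ∧ b′ ≡ false →
          (a ∧ a′ ≡ false → m₁ ≡ 0) → (b ∧ b′ ≡ false → m₂ ≡ 0) →
          1 * (⟦ a ∨ b ⟧ * ⟦ a′ ∨ b′ ⟧ * 2 ^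
              (m₁ + m₂ + (if a ∧ a′ then ∣ V₂ ∣ else if b ∧ b′ then ∣ V₁ ∣ else 0)))
          ≡ 2 ^ ∣ V₂ ∣ * (1 * (⟦ a ⟧ * ⟦ a′ ⟧ * 2 ^ m₁)) + 2 ^ ∣ V₁ ∣ * (1 * (⟦ b ⟧ * ⟦ b′ ⟧ * 2 ^ m₂))
            + 1 * (⟦ a ⟧ * ⟦ b′ ⟧ + ⟦ b ⟧ * ⟦ a′ ⟧)
  table false false _     _     m₁ m₂ _ _ _ _ = zeros (2 ^ ∣ V₂ ∣) (2 ^ ∣ V₁ ∣)
  table true  false true  false m₁ m₂ _ _ _ z₂ rewrite z₂ refl | ℕ.+-identityʳ m₁ | ℕ.^-distribˡ-+-*
      2 m₁ ∣ V₂ ∣ =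
    inner (2 ^ m₁) (2 ^ ∣ V₂ ∣) (2 ^ ∣ V₁ ∣)
    where
    inner : ∀ A P Q → 1 * (1 * (A * P)) ≡ P * (1 * (1 * A)) + Q * 0 + 0
    inner = ℕ-Solver.solve-∀
  table true  false false true  m₁ m₂ _ _ z₁ z₂ rewrite z₁ refl | z₂ refl = outer (2 ^ ∣ V₂ ∣) (2 ^ ∣ V₁ ∣)
  table true  false false false m₁ m₂ _ _ _ _ = zeros (2 ^ ∣ V₂ ∣) (2 ^ ∣ V₁ ∣)
  table false true  true  false m₁ m₂ _ _ z₁ z₂ rewrite z₁ refl | z₂ refl = outer (2 ^ ∣ V₂ ∣) (2 ^ ∣ V₁ ∣)
  table false true  false true  m₁ m₂ _ _ z₁ _ rewrite z₁ refl | ℕ.^-distribˡ-+-* 2 m₂ ∣ V₁ ∣ =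
    inner (2 ^ m₂) (2 ^ ∣ V₂ ∣) (2 ^ ∣ V₁ ∣)
    where
    inner : ∀ A P Q → 1 * (1 * (A * Q)) ≡ P * 0 + Q * (1 * (1 * A)) + 0
    inner = ℕ-Solver.solve-∀
  table false true  false false m₁ m₂ _ _ _ _ = zeros (2 ^ ∣ V₂ ∣) (2 ^ ∣ V₁ ∣)
  entry : ∀ x y → lt x y * (χ (V₁ ∪ V₂) x * χ (V₁ ∪ V₂) y * 2 ^ M x y)
                ≡ 2 ^ ∣ V₂ ∣ * F₁ x y + 2 ^ ∣ V₁ ∣ * F₂ x y + G x y
  -- Once `x` precedes `y`, the guard `x ≠ y` of `cross` evaluates to true, which leaves the
  -- conditional that appears in `table`.
  entry x y rewrite M≡ x y | Vec.lookup-zipWith _∨_ x V₁ V₂ | Vec.lookup-zipWith _∨_ y V₁ V₂ with toℕ x <ᵇ toℕ y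
  ... | true  = table (lookup V₁ x) (lookup V₂ x) (lookup V₁ y) (lookup V₂ y) (M₁ x y) (M₂ x y)
                  (disjoint-at x) (disjoint-at y) (supp₁ x y) (supp₂ x y)
  ... | false = zeros (2 ^ ∣ V₂ ∣) (2 ^ ∣ V₁ ∣)

Rec2-supported : ∀ {m} {V : Subset m} {M} → Rec2 V M → Supported V M
Rec2-supported (base _ M≡0) x y _ = M≡0 x y
Rec2-supported (split V₁ V₂ M₁ M₂ _ _ _ refl _ r₁ r₂ M≡) x y out = begin
  _
    ≡⟨ M≡ x y ⟩
  M₁ x y + M₂ x y + cross V₁ V₂ x y
    ≡⟨ cong₂ _+_ (cong₂ _+_ (Rec2-supported r₁ x y out₁) (Rec2-supported r₂ x y out₂)) cross≡0 ⟩
  0 ∎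
  where
  open ≡-Reasoning
  neither : ∀ a b a′ b′ → (a ∨ b) ∧ (a′ ∨ b′) ≡ false → a ∧ a′ ≡ false × b ∧ b′ ≡ false
  neither false false _     _     _ = refl , refl
  neither false true  false false _ = refl , refl
  neither true  false false false _ = refl , refl
  neither true  true  false false _ = refl , refl
  outs : lookup V₁ x ∧ lookup V₁ y ≡ false × lookup V₂ x ∧ lookup V₂ y ≡ false
  outs = neither (lookup V₁ x) (lookup V₂ x) (lookup V₁ y) (lookup V₂ y)
    (trans (sym (cong₂ _∧_ (Vec.lookup-zipWith _∨_ x V₁ V₂) (Vec.lookup-zipWith _∨_ y V₁ V₂))) out)
  out₁ = proj₁ outs
  out₂ = proj₂ outs
  cross≡0 : cross V₁ V₂ x y ≡ 0
  cross≡0 rewrite out₁ | out₂ with (toℕ x <ᵇ toℕ y) ∨ (toℕ y <ᵇ toℕ x)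
  ... | true  = refl
  ... | false = refl

Rec2⇒Achievable : ∀ {m} {V : Subset m} {M} → Rec2 V M → Achievable ∣ V ∣ (weight V M)
Rec2⇒Achievable {V = V} {M} (base (inj₁ ∣V∣≡1) M≡0) =
  subst₂ Achievable (sym ∣V∣≡1) (sym (trans (zero-weight V M M≡0) (pairs-1 V ∣V∣≡1))) leaf
Rec2⇒Achievable {V = V} {M} (base (inj₂ ∣V∣≡2) M≡0) =
  subst₂ Achievable (sym ∣V∣≡2) (sym (trans (zero-weight V M M≡0) (pairs-2 V ∣V∣≡2))) (branch leaf leaf)
Rec2⇒Achievable (split V₁ V₂ M₁ M₂ _ _ _ refl disjoint r₁ r₂ M≡) =
  subst₂ Achievable (sym (∣∪∣-disjoint V₁ V₂ disjoint))
    (sym (weight-split V₁ V₂ M₁ M₂ _ disjoint (Rec2-supported r₁) (Rec2-supported r₂) M≡))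
    (branch (Rec2⇒Achievable r₁) (Rec2⇒Achievable r₂))

-- Realising split trees by multigraphs

partition : ∀ {m} (V : Subset m) p q → ∣ V ∣ ≡ p + q →
            ∃[ V₁ ] ∃[ V₂ ] V₁ ∪ V₂ ≡ V × V₁ ∩ V₂ ≡ ⊥ × ∣ V₁ ∣ ≡ p × ∣ V₂ ∣ ≡ q
partition []            zero    zero    e  = [] , [] , refl , refl , refl , refl
partition (outside ∷ V) p       q       e  with V₁ , V₂ , u , d , e₁ , e₂ ← partition V p q e =
  outside ∷ V₁ , outside ∷ V₂ , cong (outside ∷_) u , cong (outside ∷_) d , e₁ , e₂
partition (inside  ∷ V) zero    (suc q) e  with V₁ , V₂ , u , d , e₁ , e₂ ← partition V zero q
    (ℕ.suc-injective e) =
  outside ∷ V₁ , inside ∷ V₂ , cong (inside ∷_) u , cong (outside ∷_) d , e₁ , cong suc e₂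
partition (inside  ∷ V) (suc p) q       e  with V₁ , V₂ , u , d , e₁ , e₂ ← partition V p q
    (ℕ.suc-injective e) =
  inside ∷ V₁ , outside ∷ V₂ , cong (inside ∷_) u , cong (outside ∷_) d , cong suc e₁ , e₂

nonempty : ∀ {m} (V : Subset m) → 1 ≤ ∣ V ∣ → Nonempty V
nonempty (inside  ∷ V) _ = zero , here
nonempty (outside ∷ V) p with x , x∈V ← nonempty V p = suc x , there x∈V

singleton-weight : ∀ {n w} → Achievable n w → n ≡ 1 → w ≡ 0
singleton-weight leaf _ = refl
singleton-weight (branch s t) e = absurd (ℕ.+-mono-≤ (Achievable-positive s) (Achievable-positive t))
    (ℕ.≤-reflexive e)

Achievable⇒Rec2 : ∀ {n w} → Achievable n w → ∀ {m} (V : Subset m) → ∣ V ∣ ≡ n → ∃[ M ] Rec2 V M × weight V M ≡ w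
Achievable⇒Rec2 leaf V e = (λ _ _ → 0) , base (inj₁ e) (λ _ _ → refl) , trans (zero-weight V _ λ _ _ → refl)
    (pairs-1 V e)
Achievable⇒Rec2 (branch {p} {q} s t) V e with 3 ℕ.≤? p + q
... | yes 3≤p+q
  with V₁ , V₂ , refl , disjoint , refl , refl ← partition V p q e
  with M₁ , r₁ , w₁ ← Achievable⇒Rec2 s V₁ refl
  with M₂ , r₂ , w₂ ← Achievable⇒Rec2 t V₂ refl =
    (λ x y → M₁ x y + M₂ x y + cross V₁ V₂ x y)
  , split V₁ V₂ M₁ M₂ (subst (3 ≤_) (sym e) 3≤p+q) (nonempty V₁ (Achievable-positive s))
      (nonempty V₂ (Achievable-positive t))
      refl disjoint r₁ r₂ (λ _ _ → refl)
  , trans (weight-split V₁ V₂ M₁ M₂ _ disjoint (Rec2-supported r₁) (Rec2-supported r₂) (λ _ _ → refl))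
      (cong₂ (node ∣ V₁ ∣ ∣ V₂ ∣) w₁ w₂)
-- Both parts are nonempty, so `p = q = 1`: the split of two vertices becomes the empty base
-- multigraph.
... | no 3≰p+q = small p q s t e (ℕ.≰⇒> 3≰p+q)
  where
  small : ∀ p q {a b} → Achievable p a → Achievable q b → ∣ V ∣ ≡ p + q → suc (p + q) ≤ 3 →
          ∃[ M ] Rec2 V M × weight V M ≡ node p q a b
  small p q s t e p+q<3 with 1≤p ← Achievable-positive s | 1≤q ← Achievable-positive t
    with refl ← ℕ.≤-antisym (ℕ.+-cancelʳ-≤ 1 p 1 (ℕ.≤-trans (ℕ.+-monoʳ-≤ p 1≤q) (ℕ.≤-pred p+q<3))) 1≤p
       | refl ← ℕ.≤-antisym (ℕ.+-cancelˡ-≤ 1 q 1 (ℕ.≤-trans (ℕ.+-monoˡ-≤ q 1≤p) (ℕ.≤-pred p+q<3))) 1≤q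
    with refl ← singleton-weight s refl | refl ← singleton-weight t refl =
    (λ _ _ → 0) , base (inj₂ e) (λ _ _ → refl) , trans (zero-weight V _ λ _ _ → refl) (pairs-2 V e)

-- The maximiser yields a split tree, whose weight `H` bounds; conversely the optimal split tree is
-- realised on all of `Fin m` and falls under the maximality bound.
IsH2⇒≡H : ∀ {m h} → 1 ≤ m → IsH2 m h → h ≡ H m
IsH2⇒≡H {m} {h} 1≤m ((M , r , w) , bound) = ℕ.≤-antisym upper lower
  where
  upper : h ≤ H m
  upper = subst₂ (λ w n → w ≤ H n) (trans (sym (weight2≡weight-⊤ M)) w) (∣⊤∣≡n m)
      (Achievable-≤H (Rec2⇒Achievable r))
  lower : H m ≤ h
  lower with M′ , r′ , w′ ← Achievable⇒Rec2 (H-achievable m 1≤m) ⊤ (∣⊤∣≡n m) =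
    subst (_≤ h) (trans (weight2≡weight-⊤ M′) w′) (bound M′ r′)

theorem5p4 : (m k : ℕ) → 2 ≤ m → m ≢ 6 →
    3 * 2 ^ k ≤ 2 * m → m < 2 ^ k + 2 ^ (k + 1) →
    (a b c : ℕ) → IsH2 m a → IsH2 (2 ^ k) b → IsH2 (m ∸ 2 ^ k) c →
    hval m a ≡ (divℕ (2 ^ k) m *ℚ hval (2 ^ k) b)
    +ℚ (divℕ (m ∸ 2 ^ k) m *ℚ hval (m ∸ 2 ^ k) c)
    +ℚ divℕ (2 ^ k * (m ∸ 2 ^ k)) (m * 2 ^ (m ∸ 1))
theorem5p4 m k 2≤m m≢6 3p≤2m m<3p a b c max-m max-p max-q =
  recurrence (ℕ.m≤n⇒∃[o]m+o≡n (halve-≤ (2p≤2m p {m} 3p≤2m)))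
  where
  p : ℕ
  p = 2 ^ k
  statement : ℕ → Set
  statement q = hval m a ≡ divℕ p m *ℚ hval p b +ℚ divℕ q m *ℚ hval q c +ℚ divℕ (p * q) (m * 2 ^ (m ∸ 1))
  recurrence : ∃[ q ] p + q ≡ m → statement (m ∸ p)
  recurrence (q , refl) = for (m ∸ p) (ℕ.m+n∸m≡n p q) max-q
    where
    -- The truncated difference `m ∸ p` is abstracted to `r`, so that it can be identified with `q`
    -- both in the formula and in the type of `max-q`.
    for : ∀ r → r ≡ q → IsH2 r c → statement r
    for r refl max-q
      with balanced ← three-halves {k} {q} 3p≤2m m<3p
      with 1≤q ← positive-half {p} (ℕ.m^n>0 2 k) (proj₁ balanced)
      with refl ← IsH2⇒≡H (ℕ.≤-trans (s≤s z≤n) 2≤m) max-m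
         | refl ← IsH2⇒≡H (ℕ.m^n>0 2 k) max-p
         | refl ← IsH2⇒≡H 1≤q max-q =
      trans (cong (hval (p + q)) (H-node k q balanced m≢6))
        (hval-node p q (H p) (H q) ⦃ ℕ.m^n≢0 2 k ⦄ ⦃ ℕ.>-nonZero 1≤q ⦄)
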